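{- Let $\pi\in\mathcal{A}^*$ and let $(\tilde{P},P^t,L)$ be the image of $\pi$ under the dual $spo$-correspondence. Then $\tilde{P}$ is an $spo(2m,n)$-tableau of some shape $\lambda$, $P^t$ is a semistandard tableau (of shape $\lambda^t$, with entries in $\{1,\dots,q\}$), and $L$ is a dual Burge two-line array.
   Context: Fix positive integers $m,n,q$. Let $B_0=\{1,\overline{1},\dots,m,\overline{m}\}$ and $B_1=\{1^\circ,\dots,n^\circ\}$, totally ordered by $1<\overline{1}<2<\overline{2}<\cdots<m<\overline{m}<1^\circ<\cdots<n^\circ$. Young diagrams are drawn with row $1$ on top. A tableau is semistandard if rows weakly increase left to right and columns strictly increase top to bottom; $P^t$ denotes the transpose of a tableau $P$. An $spo(2m,n)$-tableau of shape $\lambda$ is a filling of the Young diagram of $\lambda$ with entries of $B_0\cup B_1$ such that the boxes with entries in $B_0$ form a Young diagram of a shape $\mu\subseteq\lambda$ on which entries weakly increase along rows, strictly increase down columns, and every entry in row $i$ is $\geq i$ (no $j$ or $\overline{j}$ with $j<i$ in row $i$); and the entries of $B_1$ in $\lambda/\mu$ strictly increase along rows and weakly increase down columns. Forward slide: for a filling with one empty box, with $x$ the entry immediately to its right and $y$ the entry immediately below; if only one exists it moves in; otherwise $x$ moves left if $x<y$ or $x=y\in B_1$, and $y$ moves up if $y<x$ or $x=y\in B_0$. Repeat until the empty box is at an outer corner, and delete that box. $spo$-insertion $T\leftarrow x$: insert $z=x$ into row 1; to insert $z$ into row $r$: if $z\in B_0$ and $z\geq$ all entries of row $r$, or $z\in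 B_1$ and $z>$ all entries of row $r$ (including an empty row below the tableau), append $z$ at the end of row $r$ and stop; otherwise let $z'$ be the leftmost entry of row $r$ with $z'\geq z$ (if $z\in B_1$) or with $z'>z$ (if $z\in B_0$), replace $z'$ by $z$ and insert $z'$ into row $r+1$. If at some stage an $i\in\{1,\dots,m\}$ inserted into row $i$ would bump an $\overline{i}$ out of row $i$ (a cancellation), then at the first such stage the $\overline{i}$ is removed instead (and $i$ not placed) and forward slides move the empty box to an outer corner, where it is deleted. Thus $T\leftarrow x$ has one box more or one box fewer than $T$. $\mathcal{A}^*$ is the set of two-line arrays $\pi=\begin{pmatrix}a_1&\cdots&a_s\\ b_1&\cdots&b_s\end{pmatrix}$ with $a_i\in\{1,\dots,q\}$, $b_i\in B_0\cup B_1$, such that $a_i\leq a_{i+1}$, $a_i=a_{i+1}$ implies $b_i\geq b_{i+1}$, and each column $\binom{i}{j}$ with $j\in B_0$ occurs at most once. A dual Burge two-line array is an array $\begin{pmatrix}i_1&\cdots&i_r\\ j_1&\cdots&j_r\end{pmatrix}$ with $i_k,j_k\in\{1,\dots,q\}$, $i_k\leq i_{k+1}$, $i_k=i_{k+1}\Rightarrow j_k\geq j_{k+1}$, and $i_k\geq j_k$ for all $k$. The dual $spo$-correspondence: set $\tilde{P}_0=P_0=L_0=\emptyset$. For $k=1,\dots,s$, with $k$-th column $\binom{i}{j}$ of $\pi$, let $\tilde{P}_k=\tilde{P}_{k-1}\leftarrow j$. If a box was added, form $P_k$ by adding a box containing $i$ to $P_{k-1}$ in the position of the new box of $\tilde{P}_k$,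 and set $L_k=L_{k-1}$. If a box was removed, consider the box of $P_{k-1}$ in the position of the box of $\tilde{P}_{k-1}$ missing from $\tilde{P}_k$ and perform reverse dual row insertion: remove that box and move its entry $x$ into the row above, where it replaces the largest entry $x'$ of that row with $x'\leq x$; then $x'$ is moved into the row above it by the same rule, and so on until an entry $a$ is bumped out of the first row; let $P_k$ be the result and let $L_k$ be $L_{k-1}$ with column $\binom{i}{a}$ appended on the right. Finally $\tilde{P}=\tilde{P}_s$, $P=P_s$, and $L$ is obtained from $L_s$ by reordering, within each maximal block of columns with equal top entries, the bottom entries into weakly decreasing order. -}

module Defs where

open import Data.Nat using (ℕ; zero; suc; _+_; _*_; _≤_; _<_; _≤ᵇ_; _<ᵇ_; _≡ᵇ_; _<?_)
open import Data.Fin using (Fin; toℕ)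
open import Data.Bool using (Bool; true; false; if_then_else_; _∧_; _∨_)
open import Data.Maybe using (Maybe; just; nothing)
open import Data.Product using (_×_; _,_; proj₁; proj₂)
open import Data.List using (List; []; _∷_; _++_; [_]; length; map; upTo; concat; take; drop; mapMaybe; filter)
open import Data.Nat.ListAction using (sum)
open import Data.List.Relation.Unary.All using (All)
open import Data.List.Relation.Unary.AllPairs using (AllPairs)
open import Relation.Binary.PropositionalEquality using (_≡_)
open import Relation.Nullary using (¬_)

-- The alphabet B₀ ∪ B₁.
--   plain i  represents  i+1        (i : Fin m, so  1..m)
--   barred i represents  \bar{i+1}
--   circ j   represents  (j+1)°     (j : Fin n, so  1..n)

data Letter (m n : ℕ) : Set where
  plain  : Fin m → Letter m n
  barred : Fin m → Letter m n
  circ   : Fin n → Letter m n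

module _ {m n : ℕ} where

  -- position in the total order 1 < 1̄ < 2 < 2̄ < ... < m < m̄ < 1° < ... < n°
  rank : Letter m n → ℕ
  rank (plain i)  = 2 * toℕ i
  rank (barred i) = suc (2 * toℕ i)
  rank (circ j)   = 2 * m + toℕ j

  _≤L_ : Letter m n → Letter m n → Set
  x ≤L y = rank x ≤ rank y

  _<L_ : Letter m n → Letter m n → Set
  x <L y = rank x < rank y

  _≤Lᵇ_ : Letter m n → Letter m n → Bool
  x ≤Lᵇ y = rank x ≤ᵇ rank y

  _<Lᵇ_ : Letter m n → Letter m n → Bool
  x <Lᵇ y = rank x <ᵇ rank y

  _≡Lᵇ_ : Letter m n → Letter m n → Bool
  x ≡Lᵇ y = rank x ≡ᵇ rank y

  isB1ᵇ : Letter m n → Bool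
  isB1ᵇ (circ _) = true
  isB1ᵇ _        = false

  data IsB0 : Letter m n → Set where
    plainB0  : ∀ i → IsB0 (plain i)
    barredB0 : ∀ i → IsB0 (barred i)

  data IsB1 : Letter m n → Set where
    circB1 : ∀ j → IsB1 (circ j)

  index0 : Letter m n → ℕ
  index0 (plain i)  = suc (toℕ i)
  index0 (barred i) = suc (toℕ i)
  index0 (circ _)   = 0

-- Generic tableau utilities.  A tableau (filling of a Young diagram) is
-- the list of its rows, row 1 first; positions (r , c) are 0-based.

Tab : Set → Set
Tab A = List (List A)

module _ {A : Set} where

  at : List A → ℕ → Maybe A
  at []       _       = nothing
  at (x ∷ xs) zero    = just x
  at (x ∷ xs) (suc k) = at xs k

  entry : Tab A → ℕ → ℕ → Maybe A
  entry []         _       c = nothing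
  entry (row ∷ T)  zero    c = at row c
  entry (row ∷ T)  (suc r) c = entry T r c

  setAt : List A → ℕ → A → List A
  setAt []       _       a = []
  setAt (x ∷ xs) zero    a = a ∷ xs
  setAt (x ∷ xs) (suc k) a = x ∷ setAt xs k a

  setEntry : Tab A → ℕ → ℕ → A → Tab A
  setEntry []        _       c a = []
  setEntry (row ∷ T) zero    c a = setAt row c a ∷ T
  setEntry (row ∷ T) (suc r) c a = row ∷ setEntry T r c a

  removeAt : List A → ℕ → List A
  removeAt []       _       = []
  removeAt (x ∷ xs) zero    = xs
  removeAt (x ∷ xs) (suc k) = x ∷ removeAt xs k

  deleteBox : Tab A → ℕ → ℕ → Tab A
  deleteBox []        _       c = []
  deleteBox (row ∷ T) zero    c with removeAt row c
  ... | []      = T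
  ... | r' ∷ rs = (r' ∷ rs) ∷ T
  deleteBox (row ∷ T) (suc r) c = row ∷ deleteBox T r c

  addBox : Tab A → ℕ → A → Tab A
  addBox []        _       a = [ a ] ∷ []
  addBox (row ∷ T) zero    a = (row ++ [ a ]) ∷ T
  addBox (row ∷ T) (suc r) a = row ∷ addBox T r a

  shape : Tab A → List ℕ
  shape = map length

  size : Tab A → ℕ
  size T = sum (shape T)

  -- transpose of a tableau of partition shape: row c of T^t is column c of T
  column : ℕ → Tab A → List A
  column c T = mapMaybe (λ row → at row c) T

  transpose : Tab A → Tab A
  transpose []        = []
  transpose (row ∷ T) = map (λ c → column c (row ∷ T)) (upTo (length row))

data IsPartition : List ℕ → Set where
  []ᵖ  : IsPartition []
  [_]ᵖ : ∀ {a} → 1 ≤ a → IsPartition (a ∷ [])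
  consᵖ : ∀ {a b ps} → b ≤ a → IsPartition (b ∷ ps) → IsPartition (a ∷ b ∷ ps)

conj : List ℕ → List ℕ
conj []      = []
conj (a ∷ ps) = map (λ c → length (filter (λ p → c <? p) (a ∷ ps))) (upTo a)

record Semistandard (T : Tab ℕ) : Set where
  field
    partitionShape : IsPartition (shape T)
    rowWeak : ∀ r c x y → entry T r c ≡ just x → entry T r (suc c) ≡ just y → x ≤ y
    colStrict : ∀ r c x y → entry T r c ≡ just x → entry T (suc r) c ≡ just y → x < y

record SpoTableau {m n : ℕ} (T : Tab (Letter m n)) : Set where
  field
    partitionShape : IsPartition (shape T)
    -- the B₀-boxes form a Young diagram μ ⊆ λ
    b0LeftClosed : ∀ r c x y → entry T r c ≡ just x → entry T r (suc c) ≡ just y → IsB0 y → IsB0 x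
    b0UpClosed   : ∀ r c x y → entry T r c ≡ just x → entry T (suc r) c ≡ just y → IsB0 y → IsB0 x
    b0RowWeak    : ∀ r c x y → entry T r c ≡ just x → entry T r (suc c) ≡ just y → IsB0 x → IsB0 y → x ≤L y
    b0ColStrict  : ∀ r c x y → entry T r c ≡ just x → entry T (suc r) c ≡ just y → IsB0 x → IsB0 y → x <L y
    b0RowBound   : ∀ r c x → entry T r c ≡ just x → IsB0 x → suc r ≤ index0 x
    b1RowStrict  : ∀ r c x y → entry T r c ≡ just x → entry T r (suc c) ≡ just y → IsB1 x → IsB1 y → x <L y
    b1ColWeak    : ∀ r c x y → entry T r c ≡ just x → entry T (suc r) c ≡ just y → IsB1 x → IsB1 y → x ≤L y

module _ {m n : ℕ} where

  private
    L = Letter m n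

  bumps : L → L → Bool
  bumps z z' = if isB1ᵇ z then z ≤Lᵇ z' else z <Lᵇ z'

  findBump : L → List L → Maybe (ℕ × L)
  findBump z []       = nothing
  findBump z (y ∷ ys) = if bumps z y then just (0 , y) else
    Data.Maybe.map (λ p → (suc (proj₁ p) , proj₂ p)) (findBump z ys)

  -- cancellation: an i (i ∈ 1..m) inserted into row i (0-based row r = i-1) bumps \bar{i}
  cancels : ℕ → L → L → Bool
  cancels r (plain i) (barred j) = (toℕ i ≡ᵇ r) ∧ (toℕ i ≡ᵇ toℕ j)
  cancels r _ _ = false

  data InsResult : Set where
    -- new tableau, position of the new box
    added     : Tab L → ℕ → ℕ → InsResult
    -- tableau (rows above modified by bumping) with a hole at the given position
    cancelled : Tab L → ℕ → ℕ → InsResult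

  consRow : List L → InsResult → InsResult
  consRow row (added T r c)     = added (row ∷ T) r c
  consRow row (cancelled T r c) = cancelled (row ∷ T) r c

  -- insert z into row r (0-based) given the rows from row r downwards
  insRows : ℕ → L → Tab L → InsResult
  insRows r z []          = added ([ z ] ∷ []) r 0
  insRows r z (row ∷ T) with findBump z row
  ... | nothing        = added ((row ++ [ z ]) ∷ T) r (length row)
  ... | just (c , z')  = if cancels r z z'
                           then cancelled (row ∷ T) r c
                           else consRow (setAt row c z) (insRows (suc r) z' T)

  -- forward slides; the hole is at (r , c) (its stored content is ignored).
  -- Returns the final tableau and the outer corner where the hole was deleted.
  -- The fuel argument bounds the number of slides (each slide increases r + c).
  leftMoves : L → L → Bool
  leftMoves x y = (x <Lᵇ y) ∨ ((x ≡Lᵇ y) ∧ isB1ᵇ x)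

  slides : ℕ → Tab L → ℕ → ℕ → Tab L × (ℕ × ℕ)
  slides zero    T r c = deleteBox T r c , (r , c)
  slides (suc f) T r c with entry T r (suc c) | entry T (suc r) c
  ... | nothing | nothing = deleteBox T r c , (r , c)
  ... | just x  | nothing = slides f (setEntry T r c x) r (suc c)
  ... | nothing | just y  = slides f (setEntry T r c y) (suc r) c
  ... | just x  | just y  = if leftMoves x y
                              then slides f (setEntry T r c x) r (suc c)
                              else slides f (setEntry T r c y) (suc r) c

  data Change : Set where
    boxAdded   : ℕ → ℕ → Change
    boxRemoved : ℕ → ℕ → Change

  spoInsert : Tab L → L → Tab L × Change
  spoInsert T x with insRows 0 x T
  ... | added T' r c     = T' , boxAdded r c
  ... | cancelled T' r c with slides (suc (size T')) T' r c
  ...   | T'' , (r' , c') = T'' , boxRemoved r' c'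

replaceLE : List ℕ → ℕ → Maybe (List ℕ × ℕ)
replaceLE []       x = nothing
replaceLE (y ∷ ys) x with replaceLE ys x
... | just (ys' , a) = just (y ∷ ys' , a)
... | nothing        = if y ≤ᵇ x then just (x ∷ ys , y) else nothing

revBumpUp : Tab ℕ → ℕ → Tab ℕ × ℕ
revBumpUp []        x = [] , x
revBumpUp (row ∷ T) x with revBumpUp T x
... | T' , x₁ with replaceLE row x₁
...   | just (row' , a) = row' ∷ T' , a
...   | nothing         = row ∷ T' , x₁

revDualInsert : Tab ℕ → ℕ → ℕ → Tab ℕ × ℕ
revDualInsert P r c with entry P r c
... | nothing = P , 0
... | just x with revBumpUp (take r P) x
...   | above , a = above ++ drop r (deleteBox P r c) , a

insertDesc : ℕ × ℕ → List (ℕ × ℕ) → List (ℕ × ℕ)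
insertDesc p []       = [ p ]
insertDesc p (q ∷ qs) = if proj₂ q ≤ᵇ proj₂ p then p ∷ q ∷ qs else q ∷ insertDesc p qs

sortDesc : List (ℕ × ℕ) → List (ℕ × ℕ)
sortDesc []       = []
sortDesc (p ∷ ps) = insertDesc p (sortDesc ps)

blocks : List (ℕ × ℕ) → List (List (ℕ × ℕ))
blocks []       = []
blocks (p ∷ ps) with blocks ps
... | []                  = [ p ] ∷ []
... | []        ∷ bs      = [ p ] ∷ [] ∷ bs
... | (q ∷ qs) ∷ bs       = if proj₁ p ≡ᵇ proj₁ q then (p ∷ q ∷ qs) ∷ bs else [ p ] ∷ (q ∷ qs) ∷ bs

reorder : List (ℕ × ℕ) → List (ℕ × ℕ)
reorder L = concat (map sortDesc (blocks L))

-- the dual spo-correspondence; a two-line array is the list of its columns (top , bottom)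

module _ {m n : ℕ} where

  State : Set
  State = Tab (Letter m n) × Tab ℕ × List (ℕ × ℕ)

  step : State → ℕ × Letter m n → State
  step (Pt , P , L) (i , j) with spoInsert Pt j
  ... | Pt' , boxAdded r c   = Pt' , addBox P r i , L
  ... | Pt' , boxRemoved r c with revDualInsert P r c
  ...   | P' , a = Pt' , P' , L ++ [ (i , a) ]

  run : State → List (ℕ × Letter m n) → State
  run st []       = st
  run st (x ∷ xs) = run (step st x) xs

  dualSpo : List (ℕ × Letter m n) → State
  dualSpo π with run ([] , [] , []) π
  ... | Pt , P , L = Pt , P , reorder L

data SortedBy {A : Set} (R : A → A → Set) : List A → Set where
  nil  : SortedBy R []
  one  : ∀ {x} → SortedBy R [ x ]
  cons : ∀ {x y xs} → R x y → SortedBy R (y ∷ xs) → SortedBy R (x ∷ y ∷ xs)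

module _ {m n : ℕ} where

  ColOrderA : ℕ × Letter m n → ℕ × Letter m n → Set
  ColOrderA (a , b) (a' , b') = a ≤ a' × (a ≡ a' → b' ≤L b)

  record InAStar (q : ℕ) (π : List (ℕ × Letter m n)) : Set where
    field
      topRange : All (λ p → 1 ≤ proj₁ p × proj₁ p ≤ q) π
      ordered  : SortedBy ColOrderA π
      -- each column (i , j) with j ∈ B₀ occurs at most once
      b0Once   : AllPairs (λ p p' → p ≡ p' → IsB1 (proj₂ p)) π

ColOrderB : ℕ × ℕ → ℕ × ℕ → Set
ColOrderB (i , j) (i' , j') = i ≤ i' × (i ≡ i' → j' ≤ j)

record DualBurge (q : ℕ) (L : List (ℕ × ℕ)) : Set where
  field
    range   : All (λ p → (1 ≤ proj₁ p × proj₁ p ≤ q) × (1 ≤ proj₂ p × proj₂ p ≤ q)) L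
    ordered : SortedBy ColOrderB L
    lower   : All (λ p → proj₂ p ≤ proj₁ p) L

EntriesIn : ℕ → Tab ℕ → Set
EntriesIn q T = All (All (λ x → 1 ≤ x × x ≤ q)) T

{-# OPTIONS --safe #-}
-- Within a block of equal top entries the inserted letters form a chain in which each one would bump its
-- predecessor, so each route runs weakly left of the previous one, row by row.  Hence additions occur in
-- strictly lower rows, and a cancellation is followed only by cancellations: the next letter would reach the
-- row of the cancellation too small to be legal there, so it must cancel in a higher row.  Therefore a new box
-- of P never enters a row that already contains its entry.  That each step keeps both tableaux valid is the
-- standard argument for bumping, jeu de taquin and reverse bumping, carried out for one pair of row and
-- column relations covering both alphabets.
module Submission where

open import Defs
open import Data.Nat using (ℕ; zero; suc; _+_; _*_; _≤_; _<_; z≤n; s≤s; _≤ᵇ_; _<ᵇ_; _≡ᵇ_; _≟_; _<?_)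
open import Data.Nat.Properties
open import Data.Nat.ListAction using (sum)
open import Data.Fin using (Fin; toℕ)
open import Data.Fin.Properties using (toℕ<n; toℕ-injective)
open import Data.Bool using (Bool; true; false; T; _∧_)
open import Data.Bool.Properties using (T-≡)
open import Data.Maybe using (Maybe; just; nothing)
open import Data.Maybe.Properties using (just-injective)
open import Data.Empty using (⊥; ⊥-elim)
open import Data.Product using (_×_; _,_; proj₁; proj₂; ∃; ∃-syntax)
open import Data.Sum using (_⊎_; inj₁; inj₂)
open import Data.List using (List; []; _∷_; _++_; [_]; length; map; upTo; applyUpTo; concat; take; filter)
open import Data.List.Properties using (length-++; map-∘; map-cong; map-upTo; filter-accept; filter-reject)
open import Data.List.Relation.Unary.All using (All; []; _∷_)
import Data.List.Relation.Unary.All as All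
import Data.List.Relation.Unary.All.Properties as All
open import Data.List.Relation.Unary.AllPairs using (AllPairs; []; _∷_)
import Data.List.Relation.Unary.AllPairs as AllPairs
import Data.List.Relation.Unary.AllPairs.Properties as AllPairs
open import Function using (_∘_; id; Equivalence)
open import Relation.Nullary using (¬_; yes; no; contradiction)
open import Relation.Binary.PropositionalEquality using (_≡_; _≢_; refl; sym; trans; cong; cong₂; subst)

-- The delicate condition is that rows of `P` increase strictly. Its columns increase only weakly
-- and the top entries arrive in weakly increasing order, so a new entry can conflict only with
-- equal entries of its own row, and those belong to the same block. A cancellation would spoil any
-- bookkeeping of their positions, since reverse bumping may carry copies of the current top entry
-- into other rows. This is why it matters that no later letter of the block adds a box: the
-- positions are then irrelevant, and once the top entry grows, every older entry is smaller than
-- it.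

nothing≢just : ∀ {B : Set} {x : B} → nothing ≡ just x → ⊥
nothing≢just ()

-- Partitions and their corners

head₀ : List ℕ → ℕ
head₀ []      = 0
head₀ (a ∷ _) = a

-- Row lengths 0 and 1 are split off because `deleteBox` drops a row that becomes empty.
removeFromShape : List ℕ → ℕ → List ℕ
removeFromShape []            _       = []
removeFromShape (zero ∷ ps)   zero    = ps
removeFromShape (suc zero ∷ ps) zero  = ps
removeFromShape (suc (suc a) ∷ ps) zero = suc a ∷ ps
removeFromShape (a ∷ ps)      (suc r) = a ∷ removeFromShape ps r

addToShape : List ℕ → ℕ → List ℕ
addToShape []       _       = 1 ∷ []
addToShape (a ∷ ps) zero    = suc a ∷ ps
addToShape (a ∷ ps) (suc r) = a ∷ addToShape ps r

-- Since `head₀ [] = 0`, the last row needs no constructor of its own.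
data Corner : List ℕ → ℕ → ℕ → Set where
  here  : ∀ {ps c} → head₀ ps ≤ c → Corner (suc c ∷ ps) 0 c
  there : ∀ {a ps r c} → Corner ps r c → Corner (a ∷ ps) (suc r) c

Corner-length : ∀ {a ps c} → Corner (a ∷ ps) 0 c → a ≡ suc c
Corner-length (here _) = refl

Corner-below : ∀ {a ps c} → Corner (a ∷ ps) 0 c → head₀ ps ≤ c
Corner-below (here h) = h

partition-∷ : ∀ {a ps} → 1 ≤ a → head₀ ps ≤ a → IsPartition ps → IsPartition (a ∷ ps)
partition-∷ 1≤a _ []ᵖ              = [ 1≤a ]ᵖ
partition-∷ 1≤a h≤a [ 1≤b ]ᵖ      = consᵖ h≤a [ 1≤b ]ᵖ
partition-∷ 1≤a h≤a (consᵖ c≤b p) = consᵖ h≤a (consᵖ c≤b p)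

partition-head : ∀ {a ps} → IsPartition (a ∷ ps) → head₀ ps ≤ a
partition-head [ _ ]ᵖ        = z≤n
partition-head (consᵖ b≤a _) = b≤a

partition-tail : ∀ {a ps} → IsPartition (a ∷ ps) → IsPartition ps
partition-tail [ _ ]ᵖ      = []ᵖ
partition-tail (consᵖ _ p) = p

partition-pos : ∀ {a ps} → IsPartition (a ∷ ps) → 1 ≤ a
partition-pos [ 1≤a ]ᵖ      = 1≤a
partition-pos (consᵖ b≤a p) = ≤-trans (partition-pos p) b≤a

partition-head-0 : ∀ {ps} → IsPartition ps → head₀ ps ≤ 0 → ps ≡ []
partition-head-0 []ᵖ _ = refl
partition-head-0 p@([ _ ]ᵖ)    h≤0 = contradiction (≤-trans (partition-pos p) h≤0) λ ()
partition-head-0 p@(consᵖ _ _) h≤0 = contradiction (≤-trans (partition-pos p) h≤0) λ ()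

head₀-removeFromShape : ∀ {ps r c} → IsPartition ps → Corner ps r c → head₀ (removeFromShape ps r) ≤ head₀ ps
head₀-removeFromShape p (here {c = zero} _)  = partition-head p
head₀-removeFromShape p (here {c = suc c} _) = n≤1+n _
head₀-removeFromShape {zero ∷ _} p (there _) = ≤-refl
head₀-removeFromShape {suc zero ∷ _} p (there _) = ≤-refl
head₀-removeFromShape {suc (suc _) ∷ _} p (there _) = ≤-refl

removeFromShape-suc : ∀ a ps r → removeFromShape (a ∷ ps) (suc r) ≡ a ∷ removeFromShape ps r
removeFromShape-suc zero          ps r = refl
removeFromShape-suc (suc zero)    ps r = refl
removeFromShape-suc (suc (suc a)) ps r = refl

removeFromShape-partition : ∀ {ps r c} → IsPartition ps → Corner ps r c → IsPartition (removeFromShape ps r)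
removeFromShape-partition p (here {c = zero} _)    = partition-tail p
removeFromShape-partition p (here {c = suc c} h≤c) = partition-∷ (s≤s z≤n) h≤c (partition-tail p)
removeFromShape-partition p (there {a} {ps} {r} k) =
  subst IsPartition (sym (removeFromShape-suc a ps r))
    (partition-∷ (partition-pos p) (≤-trans (head₀-removeFromShape (partition-tail p) k) (partition-head p))
      (removeFromShape-partition (partition-tail p) k))

-- Entries and shapes when a single box changes

module _ {A : Set} where

  at-just⇒< : ∀ (xs : List A) c {x} → at xs c ≡ just x → c < length xs
  at-just⇒< (_ ∷ xs) zero    _ = s≤s z≤n
  at-just⇒< (_ ∷ xs) (suc c) e = s≤s (at-just⇒< xs c e)

  <⇒at-just : ∀ (xs : List A) c → c < length xs → ∃ λ x → at xs c ≡ just x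
  <⇒at-just (x ∷ xs) zero    _         = x , refl
  <⇒at-just (x ∷ xs) (suc c) (s≤s c<l) = <⇒at-just xs c c<l

  at-All : ∀ {Q : A → Set} {xs} → All Q xs → ∀ c {x} → at xs c ≡ just x → Q x
  at-All (q ∷ qs) zero    refl = q
  at-All (q ∷ qs) (suc c) e    = at-All qs c e

  All-at : ∀ {Q : A → Set} xs → (∀ c x → at xs c ≡ just x → Q x) → All Q xs
  All-at []       f = []
  All-at (x ∷ xs) f = f 0 x refl ∷ All-at xs (f ∘ suc)

  setAt-All : ∀ {Q : A → Set} {xs} c {a} → Q a → All Q xs → All Q (setAt xs c a)
  setAt-All c       qa []       = []
  setAt-All zero    qa (_ ∷ qs) = qa ∷ qs
  setAt-All (suc c) qa (q ∷ qs) = q ∷ setAt-All c qa qs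

  removeAt-All : ∀ {Q : A → Set} {xs} c → All Q xs → All Q (removeAt xs c)
  removeAt-All c       []       = []
  removeAt-All zero    (_ ∷ qs) = qs
  removeAt-All (suc c) (q ∷ qs) = q ∷ removeAt-All c qs

  at-setAt-same : ∀ (xs : List A) c a {x} → at xs c ≡ just x → at (setAt xs c a) c ≡ just a
  at-setAt-same (_ ∷ xs) zero    a _ = refl
  at-setAt-same (_ ∷ xs) (suc c) a e = at-setAt-same xs c a e

  at-setAt-other : ∀ (xs : List A) c c′ a → c′ ≢ c → at (setAt xs c a) c′ ≡ at xs c′
  at-setAt-other []       c       c′       a ≢ = refl
  at-setAt-other (_ ∷ xs) zero    zero     a ≢ = ⊥-elim (≢ refl)
  at-setAt-other (_ ∷ xs) zero    (suc c′) a ≢ = refl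
  at-setAt-other (_ ∷ xs) (suc c) zero     a ≢ = refl
  at-setAt-other (_ ∷ xs) (suc c) (suc c′) a ≢ = at-setAt-other xs c c′ a (≢ ∘ cong suc)

  length-setAt : ∀ (xs : List A) c a → length (setAt xs c a) ≡ length xs
  length-setAt []       c       a = refl
  length-setAt (_ ∷ xs) zero    a = refl
  length-setAt (_ ∷ xs) (suc c) a = cong suc (length-setAt xs c a)

  entry-setEntry-same : ∀ (T : Tab A) r c a {x} → entry T r c ≡ just x → entry (setEntry T r c a) r c ≡ just a
  entry-setEntry-same (row ∷ T) zero    c a e = at-setAt-same row c a e
  entry-setEntry-same (row ∷ T) (suc r) c a e = entry-setEntry-same T r c a e

  entry-setEntry-other : ∀ (T : Tab A) r c r′ c′ a → ¬ (r′ ≡ r × c′ ≡ c) →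
    entry (setEntry T r c a) r′ c′ ≡ entry T r′ c′
  entry-setEntry-other []        r       c r′       c′ a ≢ = refl
  entry-setEntry-other (row ∷ T) zero    c zero     c′ a ≢ = at-setAt-other row c c′ a λ e → ≢ (refl , e)
  entry-setEntry-other (row ∷ T) zero    c (suc r′) c′ a ≢ = refl
  entry-setEntry-other (row ∷ T) (suc r) c zero     c′ a ≢ = refl
  entry-setEntry-other (row ∷ T) (suc r) c (suc r′) c′ a ≢ =
    entry-setEntry-other T r c r′ c′ a λ { (refl , e) → ≢ (refl , e) }

  shape-setEntry : ∀ (T : Tab A) r c a → shape (setEntry T r c a) ≡ shape T
  shape-setEntry []        r       c a = refl
  shape-setEntry (row ∷ T) zero    c a = cong (_∷ shape T) (length-setAt row c a)
  shape-setEntry (row ∷ T) (suc r) c a = cong (length row ∷_) (shape-setEntry T r c a)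

  entry-setEntry⁻ : ∀ (T : Tab A) h k a {z} → entry T h k ≡ just z →
    ∀ r c {x} → entry (setEntry T h k a) r c ≡ just x →
    (r ≡ h × c ≡ k × x ≡ a) ⊎ (¬ (r ≡ h × c ≡ k) × entry T r c ≡ just x)
  entry-setEntry⁻ T h k a ez r c ex with r ≟ h | c ≟ k
  ... | yes refl | yes refl = inj₁ (refl , refl , just-injective (trans (sym ex) (entry-setEntry-same T h k a ez)))
  ... | no r≢h   | _        = inj₂ (r≢h ∘ proj₁ , trans (sym (entry-setEntry-other T h k r c a (r≢h ∘ proj₁))) ex)
  ... | yes _    | no c≢k   = inj₂ (c≢k ∘ proj₂ , trans (sym (entry-setEntry-other T h k r c a (c≢k ∘ proj₂))) ex)

  entry-closed : ∀ (T : Tab A) → IsPartition (shape T) → ∀ {r r′ c c′ y} → r ≤ r′ → c ≤ c′ →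
    entry T r′ c′ ≡ just y → ∃ λ x → entry T r c ≡ just x
  entry-closed (row ∷ T) p {zero} {zero} {c} {c′} _ c≤c′ e = <⇒at-just row c (≤-<-trans c≤c′ (at-just⇒< row c′ e))
  entry-closed (row ∷ next ∷ T) p {zero} {suc r′} {c} _ c≤c′ e =
    <⇒at-just row c (<-≤-trans (at-just⇒< next c (proj₂ (entry-closed (next ∷ T) (partition-tail p) {r′ = r′} z≤n c≤c′ e))) (partition-head p))
  entry-closed (row ∷ T) p {suc r} {suc r′} (s≤s r≤r′) c≤c′ e = entry-closed T (partition-tail p) r≤r′ c≤c′ e

  -- Each row above contributes at least one box to the size, and row `r` contributes more than `c`.
  -- This limits how far a hole can travel, hence the fuel that `slides` requires.
  entry⇒< : ∀ (T : Tab A) → IsPartition (shape T) → ∀ r c {x} → entry T r c ≡ just x → r + c < size T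
  entry⇒< (row ∷ T) p zero c e = <-≤-trans (at-just⇒< row c e) (m≤m+n _ _)
  entry⇒< (row ∷ T) p (suc r) c e = +-mono-≤ (partition-pos p) (entry⇒< T (partition-tail p) r c e)

  length-removeAt : ∀ (xs : List A) c {x} → at xs c ≡ just x → length xs ≡ suc (length (removeAt xs c))
  length-removeAt (_ ∷ xs) zero    e = refl
  length-removeAt (_ ∷ xs) (suc c) e = cong suc (length-removeAt xs c e)

  shape-deleteBox : ∀ (T : Tab A) r c {x} → entry T r c ≡ just x → shape (deleteBox T r c) ≡ removeFromShape (shape T) r
  shape-deleteBox (row ∷ T) zero c e with removeAt row c | length-removeAt row c e
  ... | []      | l rewrite l = refl
  ... | _ ∷ _   | l rewrite l = refl
  shape-deleteBox (row ∷ T) (suc r) c e =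
    trans (cong (length row ∷_) (shape-deleteBox T r c e)) (sym (removeFromShape-suc (length row) (shape T) r))

  at-removeAt-last : ∀ (xs : List A) c → length xs ≡ suc c → ∀ c′ {x} → at (removeAt xs c) c′ ≡ just x →
    at xs c′ ≡ just x × c′ ≢ c
  at-removeAt-last (_ ∷ []) zero    l c′ ()
  at-removeAt-last (_ ∷ _ ∷ xs) zero () c′ e
  at-removeAt-last (_ ∷ xs) (suc c) l zero     e = e , λ ()
  at-removeAt-last (_ ∷ xs) (suc c) l (suc c′) e with at-removeAt-last xs c (suc-injective l) c′ e
  ... | e′ , c′≢c = e′ , c′≢c ∘ suc-injective

  -- No other box moves: a corner is last in its row, and if its row disappears, then `k` is 0 and
  -- the corner condition leaves no row below that could shift up.
  entry-deleteBox : ∀ (T : Tab A) {h k} → IsPartition (shape T) → Corner (shape T) h k →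
    ∀ r c {x} → entry (deleteBox T h k) r c ≡ just x → entry T r c ≡ just x × ¬ (r ≡ h × c ≡ k)
  entry-deleteBox [] p () r c e
  entry-deleteBox (row ∷ T) {suc h} {k} p (there K) zero    c e = e , λ ()
  entry-deleteBox (row ∷ T) {suc h} {k} p (there K) (suc r) c e with entry-deleteBox T (partition-tail p) K r c e
  ... | e′ , ≢ = e′ , λ { (refl , q) → ≢ (refl , q) }
  entry-deleteBox (row ∷ T) {zero} {k} p K r c e = top (Corner-length K) (Corner-below K) r e
    where
    top : length row ≡ suc k → head₀ (shape T) ≤ k → ∀ r {x} → entry (deleteBox (row ∷ T) 0 k) r c ≡ just x →
      entry (row ∷ T) r c ≡ just x × ¬ (r ≡ 0 × c ≡ k)
    top l h r e with removeAt row k in eq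
    top l h zero e | y ∷ ys with at-removeAt-last row k l c (trans (cong (λ zs → at zs c) eq) e)
    ... | e′ , c≢k = e′ , c≢k ∘ proj₂
    top l h (suc r) e | _ ∷ _ = e , λ ()
    top l h r e | [] = ⊥-elim (empty T tail e)
      where
      k≡0 : k ≡ 0
      k≡0 = suc-injective (trans (sym l) (trans (length-removeAt row k (proj₂ (<⇒at-just row k (≤-reflexive (sym l))))) (cong (suc ∘ length) eq)))
      tail : shape T ≡ []
      tail = partition-head-0 (partition-tail p) (subst (head₀ (shape T) ≤_) k≡0 h)
      empty : ∀ (U : Tab A) → shape U ≡ [] → ∀ {x} → entry U r c ≡ just x → ⊥
      empty [] _ ()

  entries⇒Corner : ∀ (T : Tab A) r c {x} → entry T r c ≡ just x → entry T r (suc c) ≡ nothing →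
    entry T (suc r) c ≡ nothing → Corner (shape T) r c
  entries⇒Corner (row ∷ T) zero c e right below =
    subst (λ a → Corner (a ∷ shape T) 0 c) (sym len) (here (≮⇒≥ (λ c<h → above T c<h below)))
    where
    len : length row ≡ suc c
    len = ≤-antisym (≮⇒≥ λ c<l → nothing≢just (trans (sym right) (proj₂ (<⇒at-just row (suc c) c<l)))) (at-just⇒< row c e)
    above : ∀ (U : Tab A) → c < head₀ (shape U) → entry U 0 c ≡ nothing → ⊥
    above (next ∷ U) c<l e′ = nothing≢just (trans (sym e′) (proj₂ (<⇒at-just next c c<l)))
  entries⇒Corner (row ∷ T) (suc r) c e right below = there (entries⇒Corner T r c e right below)

-- A letter x is encoded by an interval [lo x , hi x] of length 0 or 1: x may stand to the left of y
-- when hi x ≤ lo y and above y when lo x < hi y.  Length 0 gives the row-weak, column-strict condition,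
-- length 1 the row-strict, column-weak one.
module Tableaux {A : Set} (lo hi : A → ℕ) (lo≤hi : ∀ x → lo x ≤ hi x) (hi≤1+lo : ∀ x → hi x ≤ suc (lo x)) where

  Row Col : A → A → Set
  Row x y = hi x ≤ lo y
  Col x y = lo x < hi y

  Row-trans : ∀ {x y z} → Row x y → Row y z → Row x z
  Row-trans r s = ≤-trans r (≤-trans (lo≤hi _) s)

  Col-trans : ∀ {x y z} → Col x y → Col y z → Col x z
  Col-trans {y = y} r s = <-≤-trans r (≤-trans (hi≤1+lo y) s)

  -- In a mixed chain both relations hold between the two ends. This law and the next each state the
  -- one that is used, the second link of the chain.
  Row-Col⇒Col : ∀ {x y z} → Row x y → Col y z → Col x z
  Row-Col⇒Col {x} r s = ≤-<-trans (lo≤hi x) (≤-<-trans r s)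

  Col-Row⇒Row : ∀ {x y z} → Col x y → Row y z → Row x z
  Col-Row⇒Row {x} r s = ≤-trans (hi≤1+lo x) (≤-trans r s)

  -- `Row x y` and `Col y x` are exact complements. Hence a letter is either bumped or may be
  -- passed, and of the two neighbours of a hole exactly one may slide in.
  Row⇒¬Col : ∀ {x y} → Row x y → ¬ Col y x
  Row⇒¬Col r s = <⇒≱ s r

  -- Tableaux described row by row

  headRow : Tab A → List A
  headRow []        = []
  headRow (row ∷ _) = row

  -- The lower row may end early, so containment of the shapes and the column condition are carried
  -- together.
  data Over : List A → List A → Set where
    []  : ∀ {xs} → Over xs []
    _∷_ : ∀ {x y xs ys} → Col x y → Over xs ys → Over (x ∷ xs) (y ∷ ys)

  data Tableau : Tab A → Set where
    []      : Tableau []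
    tableau : ∀ {row T} → 0 < length row → AllPairs Row row → Over row (headRow T) → Tableau T → Tableau (row ∷ T)

  Over-length : ∀ {xs ys} → Over xs ys → length ys ≤ length xs
  Over-length []      = z≤n
  Over-length (_ ∷ o) = s≤s (Over-length o)

  Over-at : ∀ {xs ys} → Over xs ys → ∀ c {y} → at ys c ≡ just y → ∃ λ x → at xs c ≡ just x × Col x y
  Over-at (xy ∷ o) zero    refl = _ , refl , xy
  Over-at (xy ∷ o) (suc c) e    = Over-at o c e

  Over-intro : ∀ xs ys → length ys ≤ length xs → (∀ c x y → at xs c ≡ just x → at ys c ≡ just y → Col x y) → Over xs ys
  Over-intro xs       []       _         f = []
  Over-intro (x ∷ xs) (y ∷ ys) (s≤s l≤l) f = f 0 x y refl refl ∷ Over-intro xs ys l≤l (f ∘ suc)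

  AllPairs-at : ∀ {xs} → AllPairs Row xs → ∀ {c c′ x y} → c < c′ → at xs c ≡ just x → at xs c′ ≡ just y → Row x y
  AllPairs-at (q ∷ qs) {zero}  {suc c′} _ refl ey = at-All q c′ ey
  AllPairs-at (q ∷ qs) {suc c} {suc c′} (s≤s c<c′) ex ey = AllPairs-at qs c<c′ ex ey

  AllPairs-intro : ∀ xs → (∀ c x y → at xs c ≡ just x → at xs (suc c) ≡ just y → Row x y) → AllPairs Row xs
  AllPairs-intro []           f = []
  AllPairs-intro (x ∷ [])     f = [] ∷ []
  AllPairs-intro (x ∷ y ∷ xs) f with AllPairs-intro (y ∷ xs) (f ∘ suc)
  ... | q ∷ qs = (f 0 x y refl refl ∷ All.map (Row-trans (f 0 x y refl refl)) q) ∷ q ∷ qs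

  head₀-shape : ∀ T → head₀ (shape T) ≡ length (headRow T)
  head₀-shape []      = refl
  head₀-shape (_ ∷ _) = refl

  Tableau⇒partition : ∀ {T} → Tableau T → IsPartition (shape T)
  Tableau⇒partition [] = []ᵖ
  Tableau⇒partition {row ∷ T} (tableau 0<l _ o t) =
    partition-∷ 0<l (subst (_≤ length row) (sym (head₀-shape T)) (Over-length o)) (Tableau⇒partition t)

  Tableau-rows : ∀ {T} → Tableau T → ∀ r {c c′ x y} → c < c′ → entry T r c ≡ just x → entry T r c′ ≡ just y → Row x y
  Tableau-rows (tableau _ ap _ _) zero    c<c′ ex ey = AllPairs-at ap c<c′ ex ey
  Tableau-rows (tableau _ _ _ t)  (suc r) c<c′ ex ey = Tableau-rows t r c<c′ ex ey

  Tableau-below : ∀ {row T} → Over row (headRow T) → Tableau T → ∀ r c {y} → entry T r c ≡ just y →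
    ∃ λ x → at row c ≡ just x × Col x y
  Tableau-below o (tableau _ _ _ _)  zero    c ey = Over-at o c ey
  Tableau-below o (tableau _ _ o′ t) (suc r) c ey with Tableau-below o′ t r c ey
  ... | v , ev , vy with Over-at o c ev
  ...   | x , ex , xv = x , ex , Col-trans xv vy

  Tableau-cols : ∀ {T} → Tableau T → ∀ {r r′} c {x y} → r < r′ → entry T r c ≡ just x → entry T r′ c ≡ just y → Col x y
  Tableau-cols (tableau _ _ o t) {zero} {suc r′} c _ ex ey with Tableau-below o t r′ c ey
  ... | x′ , ex′ , x′y = subst (λ z → Col z _) (just-injective (trans (sym ex′) ex)) x′y
  Tableau-cols (tableau _ _ _ t) {suc r} {suc r′} c (s≤s r<r′) ex ey = Tableau-cols t c r<r′ ex ey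

  Tableau-intro : ∀ T → IsPartition (shape T) →
    (∀ r c x y → entry T r c ≡ just x → entry T r (suc c) ≡ just y → Row x y) →
    (∀ r c x y → entry T r c ≡ just x → entry T (suc r) c ≡ just y → Col x y) → Tableau T
  Tableau-intro []        p f g = []
  Tableau-intro (row ∷ T) p f g =
    tableau (partition-pos p) (AllPairs-intro row (f 0))
      (Over-intro row (headRow T) (subst (_≤ length row) (head₀-shape T) (partition-head p))
        (λ c x y ex ey → g 0 c x y ex (headRow-entry T c ey)))
      (Tableau-intro T (partition-tail p) (f ∘ suc) (g ∘ suc))
    where
    headRow-entry : ∀ T c {y} → at (headRow T) c ≡ just y → entry T 0 c ≡ just y
    headRow-entry (_ ∷ _) c e = e

  -- Tableaux with a hole, and forward slides

  record Punctured (T : Tab A) (h k : ℕ) : Set where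
    field
      partition : IsPartition (shape T)
      hole      : ∃ λ x → entry T h k ≡ just x
      -- The letter stored at the hole is exempt from both conditions. They range over all pairs,
      -- not only neighbours, since chains of neighbours break at the hole and would not compare its
      -- two sides.
      rows      : ∀ {r c c′ x y} → c < c′ → ¬ (r ≡ h × c ≡ k) → ¬ (r ≡ h × c′ ≡ k) →
                  entry T r c ≡ just x → entry T r c′ ≡ just y → Row x y
      cols      : ∀ {r r′ c x y} → r < r′ → ¬ (r ≡ h × c ≡ k) → ¬ (r′ ≡ h × c ≡ k) →
                  entry T r c ≡ just x → entry T r′ c ≡ just y → Col x y

  puncture : ∀ {T} h k {x} → Tableau T → entry T h k ≡ just x → Punctured T h k
  puncture h k t e = record
    { partition = Tableau⇒partition t
    ; hole = _ , e
    ; rows = λ {r} c<c′ _ _ → Tableau-rows t r c<c′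
    ; cols = λ {c = c} r<r′ _ _ → Tableau-cols t c r<r′
    }

  -- New pairs arise only in column `k`. Downwards the choice of slide provides `Col`. Upwards, from
  -- an entry of column `k` one step to the right and then down to the old place of `x` is a `Row`
  -- followed by a `Col`.
  slideLeft : ∀ {T h k x} → Punctured T h k → entry T h (suc k) ≡ just x →
    (∀ y → entry T (suc h) k ≡ just y → Col x y) → Punctured (setEntry T h k x) h (suc k)
  slideLeft {T} {h} {k} {x} P ex x-above = record
    { partition = subst IsPartition (sym (shape-setEntry T h k x)) partition
    ; hole = x , trans (entry-setEntry-other T h k h (suc k) x (1+n≢n ∘ proj₂)) ex
    ; rows = rows′
    ; cols = cols′
    }
    where
    open Punctured P
    view = entry-setEntry⁻ T h k x (proj₂ hole)
    moved : ¬ (h ≡ h × suc k ≡ k)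
    moved = 1+n≢n ∘ proj₂
    rows′ : ∀ {r c c′ a b} → c < c′ → ¬ (r ≡ h × c ≡ suc k) → ¬ (r ≡ h × c′ ≡ suc k) →
      entry (setEntry T h k x) r c ≡ just a → entry (setEntry T h k x) r c′ ≡ just b → Row a b
    rows′ {r} {c} {c′} c<c′ ≢₁ ≢₂ ea eb with view r c ea | view r c′ eb
    ... | inj₁ (refl , refl , refl) | inj₁ (_ , refl , _) = ⊥-elim (<-irrefl refl c<c′)
    ... | inj₁ (refl , refl , refl) | inj₂ (≢₃ , eb′) = rows (≤∧≢⇒< c<c′ λ e → ≢₂ (refl , sym e)) moved ≢₃ ex eb′
    ... | inj₂ (≢₃ , ea′) | inj₁ (refl , refl , refl) = rows (m<n⇒m<1+n c<c′) ≢₃ moved ea′ ex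
    ... | inj₂ (≢₃ , ea′) | inj₂ (≢₄ , eb′) = rows c<c′ ≢₃ ≢₄ ea′ eb′
    cols′ : ∀ {r r′ c a b} → r < r′ → ¬ (r ≡ h × c ≡ suc k) → ¬ (r′ ≡ h × c ≡ suc k) →
      entry (setEntry T h k x) r c ≡ just a → entry (setEntry T h k x) r′ c ≡ just b → Col a b
    cols′ {r} {r′} {c} r<r′ ≢₁ ≢₂ ea eb with view r c ea | view r′ c eb
    ... | inj₁ (refl , _ , _) | inj₁ (refl , _ , _) = ⊥-elim (<-irrefl refl r<r′)
    ... | inj₁ (refl , refl , refl) | inj₂ (≢₃ , eb′) with entry-closed T partition r<r′ ≤-refl eb′ | m≤n⇒m<n∨m≡n r<r′
    ...   | y , ey | inj₂ refl = x-above _ eb′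
    ...   | y , ey | inj₁ l    = Col-trans (x-above y ey) (cols l (1+n≢n ∘ proj₁) ≢₃ ey eb′)
    cols′ {r} {r′} {c} r<r′ ≢₁ ≢₂ ea eb | inj₂ (≢₃ , ea′) | inj₁ (refl , refl , refl) with entry-closed T partition (<⇒≤ r<r′) ≤-refl ex
    ...   | b , eb′ = Row-Col⇒Col (rows ≤-refl ≢₃ ≢b ea′ eb′) (cols r<r′ ≢b moved eb′ ex)
      where
      ≢b : ¬ (r ≡ h × suc k ≡ k)
      ≢b = 1+n≢n ∘ proj₂
    cols′ r<r′ ≢₁ ≢₂ ea eb | inj₂ (≢₃ , ea′) | inj₂ (≢₄ , eb′) = cols r<r′ ≢₃ ≢₄ ea′ eb′

  -- The mirror image: new pairs arise only in row `h`. To the right the choice of slide provides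
  -- `Row`; from the left the path goes down one row and then right to the old place of `y`.
  slideUp : ∀ {T h k y} → Punctured T h k → entry T (suc h) k ≡ just y →
    (∀ x → entry T h (suc k) ≡ just x → Row y x) → Punctured (setEntry T h k y) (suc h) k
  slideUp {T} {h} {k} {y} P ey y-left = record
    { partition = subst IsPartition (sym (shape-setEntry T h k y)) partition
    ; hole = y , trans (entry-setEntry-other T h k (suc h) k y (1+n≢n ∘ proj₁)) ey
    ; rows = rows′
    ; cols = cols′
    }
    where
    open Punctured P
    view = entry-setEntry⁻ T h k y (proj₂ hole)
    moved : ∀ {c} → ¬ (suc h ≡ h × c ≡ k)
    moved = 1+n≢n ∘ proj₁
    rows′ : ∀ {r c c′ a b} → c < c′ → ¬ (r ≡ suc h × c ≡ k) → ¬ (r ≡ suc h × c′ ≡ k) →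
      entry (setEntry T h k y) r c ≡ just a → entry (setEntry T h k y) r c′ ≡ just b → Row a b
    rows′ {r} {c} {c′} c<c′ ≢₁ ≢₂ ea eb with view r c ea | view r c′ eb
    ... | inj₁ (refl , refl , refl) | inj₁ (_ , refl , _) = ⊥-elim (<-irrefl refl c<c′)
    ... | inj₁ (refl , refl , refl) | inj₂ (≢₃ , eb′) with entry-closed T partition ≤-refl c<c′ eb′ | m≤n⇒m<n∨m≡n c<c′
    ...   | x , ex | inj₂ refl = y-left _ eb′
    ...   | x , ex | inj₁ l    = Row-trans (y-left x ex) (rows l (1+n≢n ∘ proj₂) ≢₃ ex eb′)
    rows′ {r} {c} {c′} c<c′ ≢₁ ≢₂ ea eb | inj₂ (≢₃ , ea′) | inj₁ (refl , refl , refl) with entry-closed T partition ≤-refl (<⇒≤ c<c′) ey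
    ...   | b , eb′ = Col-Row⇒Row (cols ≤-refl ≢₃ moved ea′ eb′) (rows c<c′ moved moved eb′ ey)
    rows′ c<c′ ≢₁ ≢₂ ea eb | inj₂ (≢₃ , ea′) | inj₂ (≢₄ , eb′) = rows c<c′ ≢₃ ≢₄ ea′ eb′
    cols′ : ∀ {r r′ c a b} → r < r′ → ¬ (r ≡ suc h × c ≡ k) → ¬ (r′ ≡ suc h × c ≡ k) →
      entry (setEntry T h k y) r c ≡ just a → entry (setEntry T h k y) r′ c ≡ just b → Col a b
    cols′ {r} {r′} {c} r<r′ ≢₁ ≢₂ ea eb with view r c ea | view r′ c eb
    ... | inj₁ (refl , _ , _) | inj₁ (refl , _ , _) = ⊥-elim (<-irrefl refl r<r′)
    ... | inj₁ (refl , refl , refl) | inj₂ (≢₃ , eb′) = cols (≤∧≢⇒< r<r′ λ e → ≢₂ (sym e , refl)) moved ≢₃ ey eb′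
    ... | inj₂ (≢₃ , ea′) | inj₁ (refl , refl , refl) = cols (m<n⇒m<1+n r<r′) ≢₃ moved ea′ ey
    ... | inj₂ (≢₃ , ea′) | inj₂ (≢₄ , eb′) = cols r<r′ ≢₃ ≢₄ ea′ eb′

  deleteHole : ∀ {T h k} → Punctured T h k → Corner (shape T) h k → Tableau (deleteBox T h k)
  deleteHole {T} {h} {k} P K = Tableau-intro (deleteBox T h k)
    (subst IsPartition (sym (shape-deleteBox T h k (proj₂ hole))) (removeFromShape-partition partition K))
    (λ r c x y ex ey → let ex′ , ≢₁ = old r c ex ; ey′ , ≢₂ = old r (suc c) ey in rows ≤-refl ≢₁ ≢₂ ex′ ey′)
    (λ r c x y ex ey → let ex′ , ≢₁ = old r c ex ; ey′ , ≢₂ = old (suc r) c ey in cols ≤-refl ≢₁ ≢₂ ex′ ey′)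
    where
    open Punctured P
    old = entry-deleteBox T partition K

  -- Bumping in one row and in two adjacent rows

  data Bump (z : A) : List A → List A → A → ℕ → Set where
    here  : ∀ {w ys} → Col z w → Bump z (w ∷ ys) (z ∷ ys) w 0
    there : ∀ {y ys ys′ w c} → Row y z → Bump z ys ys′ w c → Bump z (y ∷ ys) (y ∷ ys′) w (suc c)

  Bump-Col : ∀ {z row row′ w c} → Bump z row row′ w c → Col z w
  Bump-Col (here zw)   = zw
  Bump-Col (there _ b) = Bump-Col b

  Bump-All : ∀ {Q : A → Set} {z row row′ w c} → Bump z row row′ w c → Q z → All Q row → All Q row′
  Bump-All (here _)    qz (_ ∷ qs) = qz ∷ qs
  Bump-All (there _ b) qz (q ∷ qs) = q ∷ Bump-All b qz qs

  Bump-All-bumped : ∀ {Q : A → Set} {z row row′ w c} → Bump z row row′ w c → All Q row → Q w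
  Bump-All-bumped (here _)    (q ∷ _)  = q
  Bump-All-bumped (there _ b) (_ ∷ qs) = Bump-All-bumped b qs

  Bump-AllPairs : ∀ {z row row′ w c} → Bump z row row′ w c → AllPairs Row row → AllPairs Row row′
  Bump-AllPairs (here zw)    (q ∷ qs) = All.map (Col-Row⇒Row zw) q ∷ qs
  Bump-AllPairs (there yz b) (q ∷ qs) = Bump-All b yz q ∷ Bump-AllPairs b qs

  Bump-length : ∀ {z row row′ w c} → Bump z row row′ w c → length row′ ≡ length row
  Bump-length (here _)    = refl
  Bump-length (there _ b) = cong suc (Bump-length b)

  Bump-at : ∀ {z row row′ w c} → Bump z row row′ w c → at row c ≡ just w
  Bump-at (here _)    = refl
  Bump-at (there _ b) = Bump-at b

  Over-Bump-above : ∀ {z row row′ w c next} → Bump z row row′ w c → Over row next → Over row′ next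
  Over-Bump-above b            []       = []
  Over-Bump-above (here zw)    (wu ∷ o) = Col-trans zw wu ∷ o
  Over-Bump-above (there yz b) (yu ∷ o) = yu ∷ Over-Bump-above b o

  -- An entry bumped out of column c lands weakly left of c in the next row.
  Over-Bump-Bump : ∀ {z row row′ w c next next′ v d} → Bump z row row′ w c → Over row next →
    Bump w next next′ v d → Over row′ next′
  Over-Bump-Bump (here zw)    (_ ∷ o)  (here _)     = zw ∷ o
  Over-Bump-Bump (here zw)    (wu ∷ _) (there uw _) = ⊥-elim (Row⇒¬Col uw wu)
  Over-Bump-Bump (there yz b) (_ ∷ o)  (here _)     = Row-Col⇒Col yz (Bump-Col b) ∷ Over-Bump-above b o
  Over-Bump-Bump (there yz b) (yu ∷ o) (there _ b′) = yu ∷ Over-Bump-Bump b o b′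

  -- The next row ends before the column that `w` left: an entry `u` there would lie under `w`, and
  -- `Col w u` contradicts `Row u w`.
  Over-Bump-append : ∀ {z row row′ w c next} → Bump z row row′ w c → Over row next →
    All (λ u → Row u w) next → Over row′ (next ++ [ w ])
  Over-Bump-append (here zw)    []       []       = zw ∷ []
  Over-Bump-append (here zw)    (wu ∷ _) (uw ∷ _) = ⊥-elim (Row⇒¬Col uw wu)
  Over-Bump-append (there yz b) []       []       = Row-Col⇒Col yz (Bump-Col b) ∷ []
  Over-Bump-append (there yz b) (yu ∷ o) (_ ∷ us) = yu ∷ Over-Bump-append b o us

  Over-++ : ∀ {row next} zs → Over row next → Over (row ++ zs) next
  Over-++ zs []      = []
  Over-++ zs (c ∷ o) = c ∷ Over-++ zs o

  -- The letter `z′` bumps `z` itself or some `y` to its left. In the first case `Col z w` is at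
  -- hand, in the second `Row y z` and `Col z w` combine. The relation between the two inserted
  -- letters is thus handed on to the two bumped ones, which is the induction step for comparing
  -- routes.
  Bump-again : ∀ {z row row′ w c z′ row″ w′ d} → Bump z row row′ w c → Col z′ z →
    Bump z′ row′ row″ w′ d → Col w′ w
  Bump-again (here zw)    z′z (here _)      = zw
  Bump-again (here zw)    z′z (there zz′ _) = ⊥-elim (Row⇒¬Col zz′ z′z)
  Bump-again (there yz b) z′z (here _)      = Row-Col⇒Col yz (Bump-Col b)
  Bump-again (there yz b) z′z (there _ b′)  = Bump-again b z′z b′

  Bump-not-append : ∀ {z row row′ w c z′} → Bump z row row′ w c → Col z′ z → ¬ All (λ y → Row y z′) row′
  Bump-not-append (here _)    z′z (zz′ ∷ _) = Row⇒¬Col zz′ z′z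
  Bump-not-append (there _ b) z′z (_ ∷ rs)  = Bump-not-append b z′z rs

-- Boolean comparisons

≤ᵇ-true : ∀ a b → (a ≤ᵇ b) ≡ true → a ≤ b
≤ᵇ-true a b e = ≤ᵇ⇒≤ a b (Equivalence.from T-≡ e)

≤ᵇ-false : ∀ a b → (a ≤ᵇ b) ≡ false → b < a
≤ᵇ-false a b e = ≰⇒> λ a≤b → subst T e (≤⇒≤ᵇ a≤b)

<ᵇ-true : ∀ a b → (a <ᵇ b) ≡ true → a < b
<ᵇ-true a b e = <ᵇ⇒< a b (Equivalence.from T-≡ e)

<ᵇ-false : ∀ a b → (a <ᵇ b) ≡ false → b ≤ a
<ᵇ-false a b e = ≮⇒≥ λ a<b → subst T e (<⇒<ᵇ a<b)

≡ᵇ-true : ∀ a b → (a ≡ᵇ b) ≡ true → a ≡ b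
≡ᵇ-true a b e = ≡ᵇ⇒≡ a b (Equivalence.from T-≡ e)

-- The alphabet and row insertion

module _ {m n : ℕ} where

  hiRank : Letter m n → ℕ
  hiRank (plain i)  = rank {m} {n} (plain i)
  hiRank (barred i) = rank {m} {n} (barred i)
  hiRank (circ j)   = suc (rank {m} {n} (circ j))

  rank≤hiRank : ∀ x → rank x ≤ hiRank x
  rank≤hiRank (plain i)  = ≤-refl
  rank≤hiRank (barred i) = ≤-refl
  rank≤hiRank (circ j)   = n≤1+n _

  hiRank≤1+rank : ∀ x → hiRank x ≤ suc (rank x)
  hiRank≤1+rank (plain i)  = n≤1+n _
  hiRank≤1+rank (barred i) = n≤1+n _
  hiRank≤1+rank (circ j)   = ≤-refl

  rank-plain<2m : ∀ (i : Fin m) → 2 * toℕ i < 2 * m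
  rank-plain<2m i = *-monoʳ-< 2 (toℕ<n i)

  rank-barred<2m : ∀ (i : Fin m) → suc (2 * toℕ i) < 2 * m
  rank-barred<2m i = subst (_≤ 2 * m) (cong suc (+-suc (toℕ i) (toℕ i + 0))) (*-monoʳ-≤ 2 (toℕ<n i))

  rank-B0<circ : ∀ {x : Letter m n} → IsB0 x → ∀ j → rank x < rank {m} {n} (circ j)
  rank-B0<circ (plainB0 i)  j = <-≤-trans (rank-plain<2m i) (m≤m+n _ _)
  rank-B0<circ (barredB0 i) j = <-≤-trans (rank-barred<2m i) (m≤m+n _ _)

module Spo {m n : ℕ} = Tableaux {Letter m n} rank hiRank rank≤hiRank hiRank≤1+rank

-- Every interval has length one, so rows are strict and columns weak: the transpose of
-- semistandardness.
module Recording = Tableaux {ℕ} id suc n≤1+n (λ _ → ≤-refl)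

module _ {m n : ℕ} where

  open Spo {m} {n}

  private
    L = Letter m n

  bumps-true : ∀ (x y : L) → bumps x y ≡ true → Col x y
  bumps-true x@(plain i)  y e = <-≤-trans (<ᵇ-true (rank x) (rank y) e) (rank≤hiRank y)
  bumps-true x@(barred i) y e = <-≤-trans (<ᵇ-true (rank x) (rank y) e) (rank≤hiRank y)
  bumps-true x@(circ j) y@(plain i)  e = ⊥-elim (<⇒≱ (rank-B0<circ (plainB0 i) j) (≤ᵇ-true (rank x) (rank y) e))
  bumps-true x@(circ j) y@(barred i) e = ⊥-elim (<⇒≱ (rank-B0<circ (barredB0 i) j) (≤ᵇ-true (rank x) (rank y) e))
  bumps-true x@(circ j) y@(circ k)   e = s≤s (≤ᵇ-true (rank x) (rank y) e)

  -- Only letters of B₀ have rank at most that of a letter of B₀, and their intervals are single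
  -- points.
  rank≤⇒hi≤ : ∀ {x y : L} → IsB0 x → rank y ≤ rank x → hiRank y ≤ rank x
  rank≤⇒hi≤ {y = plain i}  b y≤x = y≤x
  rank≤⇒hi≤ {y = barred i} b y≤x = y≤x
  rank≤⇒hi≤ {y = circ k}   b y≤x = ⊥-elim (<⇒≱ (rank-B0<circ b k) y≤x)

  bumps-false : ∀ (x y : L) → bumps x y ≡ false → Row y x
  bumps-false x@(circ j)   y e = ≤-trans (hiRank≤1+rank y) (≤ᵇ-false (rank x) (rank y) e)
  bumps-false x@(plain i)  y e = rank≤⇒hi≤ {x} {y} (plainB0 i) (<ᵇ-false (rank x) (rank y) e)
  bumps-false x@(barred i) y e = rank≤⇒hi≤ {x} {y} (barredB0 i) (<ᵇ-false (rank x) (rank y) e)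

  -- The tie rule of the slides matches the intervals: two equal letters of B₁ satisfy `Col`, two
  -- equal letters of B₀ satisfy `Row`.
  leftMoves-true : ∀ (x y : L) → leftMoves x y ≡ true → Col x y
  leftMoves-true x y e with rank x <ᵇ rank y in lt | rank x ≡ᵇ rank y in eq
  leftMoves-true x y e | true | _ = <-≤-trans (<ᵇ-true (rank x) (rank y) lt) (rank≤hiRank y)
  leftMoves-true x@(circ j) y@(circ k) e | false | true = s≤s (≤-reflexive (≡ᵇ-true (rank x) (rank y) eq))
  leftMoves-true x@(circ j) y@(plain i) e | false | true =
    ⊥-elim (<⇒≢ (rank-B0<circ (plainB0 i) j) (sym (≡ᵇ-true (rank x) (rank y) eq)))
  leftMoves-true x@(circ j) y@(barred i) e | false | true =
    ⊥-elim (<⇒≢ (rank-B0<circ (barredB0 i) j) (sym (≡ᵇ-true (rank x) (rank y) eq)))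

  leftMoves-false : ∀ (x y : L) → leftMoves x y ≡ false → Row y x
  leftMoves-false x y e with rank x <ᵇ rank y in lt | rank x ≡ᵇ rank y in eq
  leftMoves-false x y e | false | false =
    ≤-trans (hiRank≤1+rank y) (≤∧≢⇒< (<ᵇ-false (rank x) (rank y) lt) λ r → subst T eq (≡⇒≡ᵇ (rank x) (rank y) (sym r)))
  leftMoves-false x@(plain i)  y e | false | true = rank≤⇒hi≤ {x} {y} (plainB0 i) (<ᵇ-false (rank x) (rank y) lt)
  leftMoves-false x@(barred i) y e | false | true = rank≤⇒hi≤ {x} {y} (barredB0 i) (<ᵇ-false (rank x) (rank y) lt)

  Legal : ℕ → L → Set
  Legal r x = IsB0 x → suc r ≤ index0 x

  data Bounded : ℕ → Tab L → Set where
    []  : ∀ {r} → Bounded r []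
    _∷_ : ∀ {r row T} → All (Legal r) row → Bounded (suc r) T → Bounded r (row ∷ T)

  -- The only letters of row r + 1 that are illegal one row below are r + 1 and its barred version (counting
  -- from 1); the former is never bumped by a legal letter, and the latter only by the former.
  Legal-bumped : ∀ {r} {z w : L} → Legal r z → Legal r w → Col z w → cancels r z w ≡ false → Legal (suc r) w
  Legal-bumped {r} {plain i} {plain k} lz lw zw e _ =
    s≤s (≤-<-trans (≤-pred (lz (plainB0 i))) (*-cancelˡ-< 2 (toℕ i) (toℕ k) zw))
  Legal-bumped {r} {barred i} {plain k} lz lw zw e _ =
    s≤s (≤-<-trans (≤-pred (lz (barredB0 i))) (*-cancelˡ-< 2 (toℕ i) (toℕ k) (<-trans ≤-refl zw)))
  Legal-bumped {r} {circ j} {plain k} lz lw zw e _ = ⊥-elim (<-asym zw (rank-B0<circ (plainB0 k) j))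
  Legal-bumped {r} {circ j} {barred k} lz lw zw e _ = ⊥-elim (<-asym zw (rank-B0<circ (barredB0 k) j))
  Legal-bumped {r} {barred i} {barred k} lz lw zw e _ =
    s≤s (≤-<-trans (≤-pred (lz (barredB0 i))) (*-cancelˡ-< 2 (toℕ i) (toℕ k) (≤-pred zw)))
  Legal-bumped {r} {plain i} {barred k} lz lw zw e _ = s≤s (≤∧≢⇒< r≤k r≢k)
    where
    r≤k : r ≤ toℕ k
    r≤k = ≤-pred (lw (barredB0 k))
    i≤k : toℕ i ≤ toℕ k
    i≤k = *-cancelˡ-≤ 2 (≤-pred zw)
    r≢k : r ≢ toℕ k
    r≢k refl with ≤-antisym i≤k (≤-pred (lz (plainB0 i)))
    ... | i≡k = equal-indices e
      where
      equal-indices : ((toℕ i ≡ᵇ toℕ k) ∧ (toℕ i ≡ᵇ toℕ k)) ≡ false → ⊥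
      equal-indices e with toℕ i ≡ᵇ toℕ k | ≡⇒≡ᵇ (toℕ i) (toℕ k) i≡k
      equal-indices () | true | _
  Legal-bumped {w = circ k} lz lw zw e ()

  cancels-true : ∀ r (z w : L) → cancels r z w ≡ true → ∃ λ i → z ≡ plain i × toℕ i ≡ r
  cancels-true r (plain i) (barred k) e with toℕ i ≡ᵇ r in eq
  ... | true = i , refl , ≡ᵇ-true (toℕ i) r eq

  -- Among the letters legal in the row with 0-based index `toℕ i`, `plain i` is the least, and
  -- `Col z (plain i)` is strict because its interval is a point.
  illegal-before-plain : ∀ (i : Fin m) {z : L} → Legal (toℕ i) z → ¬ Col z (plain i)
  illegal-before-plain i {plain k}  l zi = <⇒≱ (*-cancelˡ-< 2 (toℕ k) (toℕ i) zi) (≤-pred (l (plainB0 k)))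
  illegal-before-plain i {barred k} l zi = <⇒≱ (*-cancelˡ-< 2 (toℕ k) (toℕ i) (<-trans ≤-refl zi)) (≤-pred (l (barredB0 k)))
  illegal-before-plain i {circ k}   l zi = <-asym zi (rank-B0<circ (plainB0 i) k)

  -- Graphs of the two outcomes of row insertion; k counts rows from the one where the insertion starts.
  data Added : ℕ → L → Tab L → Tab L → ℕ → Set where
    new    : ∀ {r z} → Added r z [] ([ z ] ∷ []) 0
    append : ∀ {r z row T} → All (λ y → Row y z) row → Added r z (row ∷ T) ((row ++ [ z ]) ∷ T) 0
    bump   : ∀ {r z row row′ w c T T′ k} → Bump z row row′ w c → cancels r z w ≡ false →
             Added (suc r) w T T′ k → Added r z (row ∷ T) (row′ ∷ T′) (suc k)

  data Cancelled : ℕ → L → Tab L → Tab L → ℕ → ℕ → Set where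
    cancel : ∀ {r z row row′ w c T} → Bump z row row′ w c → cancels r z w ≡ true →
             Cancelled r z (row ∷ T) (row ∷ T) 0 c
    bump   : ∀ {r z row row′ w c T T′ k d} → Bump z row row′ w c → cancels r z w ≡ false →
             Cancelled (suc r) w T T′ k d → Cancelled r z (row ∷ T) (row′ ∷ T′) (suc k) d

  findBump-nothing : ∀ (z : L) row → findBump z row ≡ nothing → All (λ y → Row y z) row
  findBump-nothing z []        e = []
  findBump-nothing z (y ∷ row) e with bumps z y in b | findBump z row in eq
  ... | false | nothing = bumps-false z y b ∷ findBump-nothing z row eq

  findBump-just : ∀ (z : L) row {c w} → findBump z row ≡ just (c , w) → Bump z row (setAt row c z) w c
  findBump-just z (y ∷ row) e with bumps z y in b | findBump z row in eq
  findBump-just z (y ∷ row) refl | true  | _      = here (bumps-true z y b)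
  findBump-just z (y ∷ row) refl | false | just _ = there (bumps-false z y b) (findBump-just z row eq)

  insRows-outcome : ∀ r (z : L) T →
      (∃[ T′ ] ∃[ k ] ∃[ c ] insRows r z T ≡ added T′ (k + r) c × Added r z T T′ k)
    ⊎ (∃[ T′ ] ∃[ k ] ∃[ c ] insRows r z T ≡ cancelled T′ (k + r) c × Cancelled r z T T′ k c)
  insRows-outcome r z [] = inj₁ (_ , 0 , 0 , refl , new)
  insRows-outcome r z (row ∷ T) with findBump z row in eq
  ... | nothing = inj₁ (_ , 0 , _ , refl , append (findBump-nothing z row eq))
  ... | just (c , w) with cancels r z w in cw
  ...   | true = inj₂ (_ , 0 , _ , refl , cancel (findBump-just z row eq) cw)
  ...   | false with insRows-outcome (suc r) w T
  ...     | inj₁ (T′ , k , d , e , a) =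
    inj₁ (_ , suc k , d , trans (cong (consRow _) e) (cong (λ p → added (setAt row c z ∷ T′) p d) (+-suc k r)) , bump (findBump-just z row eq) cw a)
  ...     | inj₂ (T′ , k , d , e , a) =
    inj₂ (_ , suc k , d , trans (cong (consRow _) e) (cong (λ p → cancelled (setAt row c z ∷ T′) p d) (+-suc k r)) , bump (findBump-just z row eq) cw a)

  Over-Added : ∀ {z row row′ w c r T T′ k} → Bump z row row′ w c → Over row (headRow T) →
    Added r w T T′ k → Over row′ (headRow T′)
  Over-Added b o new           = Over-Bump-append b o []
  Over-Added b o (append rs)   = Over-Bump-append b o rs
  Over-Added b o (bump b′ _ _) = Over-Bump-Bump b o b′

  Over-Cancelled : ∀ {z row row′ w c r T T′ k d} → Bump z row row′ w c → Over row (headRow T) →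
    Cancelled r w T T′ k d → Over row′ (headRow T′)
  Over-Cancelled b o (cancel _ _)  = Over-Bump-above b o
  Over-Cancelled b o (bump b′ _ _) = Over-Bump-Bump b o b′

  Bump-nonempty : ∀ {z : L} {row row′ w c} → Bump z row row′ w c → 0 < length row′
  Bump-nonempty (here _)    = s≤s z≤n
  Bump-nonempty (there _ _) = s≤s z≤n

  Added-Tableau : ∀ {r z T T′ k} → Added r z T T′ k → Tableau T → Tableau T′
  Added-Tableau new [] = tableau (s≤s z≤n) ([] ∷ []) [] []
  Added-Tableau (append {z = z} {row = row} rs) (tableau 0<l ap o t) =
    tableau (≤-trans 0<l (subst (length row ≤_) (sym (length-++ row)) (m≤m+n _ _)))
      (AllPairs.++⁺ ap ([] ∷ []) (All.map (_∷ []) rs)) (Over-++ [ z ] o) t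
  Added-Tableau (bump b _ a) (tableau _ ap o t) =
    tableau (Bump-nonempty b) (Bump-AllPairs b ap) (Over-Added b o a) (Added-Tableau a t)

  Cancelled-Tableau : ∀ {r z T T′ k d} → Cancelled r z T T′ k d → Tableau T → Tableau T′
  Cancelled-Tableau (cancel _ _) t = t
  Cancelled-Tableau (bump b _ a) (tableau _ ap o t) =
    tableau (Bump-nonempty b) (Bump-AllPairs b ap) (Over-Cancelled b o a) (Cancelled-Tableau a t)

  Bump-Legal : ∀ {r z row row′ w c} → Bump z row row′ w c → cancels r z w ≡ false →
    All (Legal r) row → Legal r z → Legal (suc r) w
  Bump-Legal {w = w} b e ls lz = Legal-bumped {w = w} lz (Bump-All-bumped b ls) (Bump-Col b) e

  Added-Bounded : ∀ {r z T T′ k} → Added r z T T′ k → Bounded r T → Legal r z → Bounded r T′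
  Added-Bounded new          _         lz = (lz ∷ []) ∷ []
  Added-Bounded (append _)   (ls ∷ bs) lz = All.++⁺ ls (lz ∷ []) ∷ bs
  Added-Bounded (bump b e a) (ls ∷ bs) lz = Bump-All b lz ls ∷ Added-Bounded a bs (Bump-Legal b e ls lz)

  Cancelled-Bounded : ∀ {r z T T′ k d} → Cancelled r z T T′ k d → Bounded r T → Legal r z → Bounded r T′
  Cancelled-Bounded (cancel _ _) bs        lz = bs
  Cancelled-Bounded (bump b e a) (ls ∷ bs) lz = Bump-All b lz ls ∷ Cancelled-Bounded a bs (Bump-Legal b e ls lz)

  Added-shape : ∀ {r z T T′ k} → Added r z T T′ k → shape T′ ≡ addToShape (shape T) k
  Added-shape new = refl
  Added-shape (append {row = row} _) = cong (_∷ _) (trans (length-++ row) (+-comm _ 1))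
  Added-shape (bump b _ a) = cong₂ _∷_ (Bump-length b) (Added-shape a)

  Cancelled-shape : ∀ {r z T T′ k d} → Cancelled r z T T′ k d → shape T′ ≡ shape T
  Cancelled-shape (cancel _ _) = refl
  Cancelled-shape (bump b _ a) = cong₂ _∷_ (Bump-length b) (Cancelled-shape a)

  Cancelled-hole : ∀ {r z T T′ k d} → Cancelled r z T T′ k d → ∃ λ x → entry T′ k d ≡ just x
  Cancelled-hole (cancel b _) = _ , Bump-at b
  Cancelled-hole (bump _ _ a) = Cancelled-hole a

  -- As long as both routes run, `Bump-again` keeps the second letter in the relation `Col` to the
  -- first. In row `k` it then meets the letter appended by the first route, which it can bump, so
  -- it cannot be appended there.
  Added-Added : ∀ {r z T T′ k z′ T″ k′} → Added r z T T′ k → Col z′ z → Added r z′ T′ T″ k′ → k < k′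
  Added-Added {z = z} {z′ = z′} new z′z (append (zz′ ∷ [])) = ⊥-elim (Row⇒¬Col {z} {z′} zz′ z′z)
  Added-Added new z′z (bump _ _ _) = s≤s z≤n
  Added-Added {z = z} {z′ = z′} (append {row = row} _) z′z (append rs) = ⊥-elim (Row⇒¬Col {z} {z′} (All.head (All.++⁻ʳ row rs)) z′z)
  Added-Added (append _) z′z (bump _ _ _) = s≤s z≤n
  Added-Added {z′ = z′} (bump b _ a) z′z (append rs) = ⊥-elim (Bump-not-append {z′ = z′} b z′z rs)
  Added-Added (bump b _ a) z′z (bump b′ _ a′) = s≤s (Added-Added a (Bump-again b z′z b′) a′)

  -- A hole moves only right or down, so the rows above a cancellation stay as bumping left them.
  -- Those are the rows in which a later route has to be compared with the cancelled one.
  slides-∷ : ∀ f row (T : Tab L) r c →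
    slides f (row ∷ T) (suc r) c ≡ (row ∷ proj₁ (slides f T r c) , suc (proj₁ (proj₂ (slides f T r c))) , proj₂ (proj₂ (slides f T r c)))
  slides-∷ zero    row T r c = refl
  slides-∷ (suc f) row T r c with entry T r (suc c) | entry T (suc r) c
  ... | nothing | nothing = refl
  ... | just x  | nothing = slides-∷ f row (setEntry T r c x) r (suc c)
  ... | nothing | just y  = slides-∷ f row (setEntry T r c y) (suc r) c
  ... | just x  | just y with leftMoves x y
  ...   | true  = slides-∷ f row (setEntry T r c x) r (suc c)
  ...   | false = slides-∷ f row (setEntry T r c y) (suc r) c

  -- The route of z′ stays weakly left of that of z, each letter of it bumping the corresponding one of z, as
  -- long as it continues; in the row of the cancellation its letter would be too small to be legal.
  Cancelled-not-Added : ∀ {r z T T′ k d} → Cancelled r z T T′ k d → ∀ f {z′ T″ k′} → Bounded r T → Legal r z → Legal r z′ →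
    Col z′ z → ¬ Added r z′ (proj₁ (slides f T′ k d)) T″ k′
  Cancelled-not-Added {r} {z} (cancel {w = w} b e) f bs lz lz′ z′z _ with cancels-true r z w e
  ... | i , refl , refl = illegal-before-plain i lz′ z′z
  Cancelled-not-Added {r} {T′ = row′ ∷ T′} {suc k} {d} (bump b e a) f {z′} (ls ∷ bs) lz lz′ z′z A
    rewrite slides-∷ f row′ T′ k d with A
  ... | append rs = Bump-not-append {z′ = z′} b z′z rs
  ... | bump b′ e′ a′ = Cancelled-not-Added a f bs (Bump-Legal b e ls lz)
    (Bump-Legal b′ e′ (Bump-All b lz ls) lz′) (Bump-again b z′z b′) a′

  -- Row bounds and validity under slides

  setEntry-Bounded : ∀ {s T} r c {a} → Bounded s T → Legal (r + s) a → Bounded s (setEntry T r c a)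
  setEntry-Bounded r       c []        la = []
  setEntry-Bounded zero    c (ls ∷ bs) la = setAt-All c la ls ∷ bs
  setEntry-Bounded {s} (suc r) c {a} (ls ∷ bs) la = ls ∷ setEntry-Bounded r c bs (subst (λ t → Legal t a) (sym (+-suc r s)) la)

  Bounded-entry : ∀ {s T} → Bounded s T → ∀ r c {x} → entry T r c ≡ just x → Legal (r + s) x
  Bounded-entry (ls ∷ bs) zero    c e = at-All ls c e
  Bounded-entry {s} (ls ∷ bs) (suc r) c {x} e = subst (λ t → Legal t x) (+-suc r s) (Bounded-entry bs r c e)

  Legal-above : ∀ {r} {x : L} → Legal (suc r) x → Legal r x
  Legal-above l b = ≤-trans (n≤1+n _) (l b)

  Bounded-above : ∀ {s T} → Bounded (suc s) T → Bounded s T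
  Bounded-above []        = []
  Bounded-above (ls ∷ bs) = All.map (λ {x} → Legal-above {x = x}) ls ∷ Bounded-above bs

  deleteBox-Bounded : ∀ {s T} r c → Bounded s T → Bounded s (deleteBox T r c)
  deleteBox-Bounded r       c []        = []
  deleteBox-Bounded (suc r) c (ls ∷ bs) = ls ∷ deleteBox-Bounded r c bs
  deleteBox-Bounded {T = row ∷ T} zero c (ls ∷ bs) with removeAt row c | removeAt-All {xs = row} c ls
  -- The row has vanished and the rows below move up by one, where the bound is weaker.
  ... | []    | _   = Bounded-above bs
  ... | _ ∷ _ | ls′ = ls′ ∷ bs

  -- A sliding letter stays in its row or rises by one row, where the bound is weaker.
  slides-Bounded : ∀ f T r c → Bounded 0 T → Bounded 0 (proj₁ (slides f T r c))
  slides-Bounded zero    T r c bs = deleteBox-Bounded r c bs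
  slides-Bounded (suc f) T r c bs with entry T r (suc c) in ex | entry T (suc r) c in ey
  ... | nothing | nothing = deleteBox-Bounded r c bs
  ... | just x  | nothing = slides-Bounded f _ r (suc c) (setEntry-Bounded r c bs (Bounded-entry bs r (suc c) ex))
  ... | nothing | just y  = slides-Bounded f _ (suc r) c (setEntry-Bounded r c bs (Legal-above {x = y} (Bounded-entry bs (suc r) c ey)))
  ... | just x  | just y with leftMoves x y
  ...   | true  = slides-Bounded f _ r (suc c) (setEntry-Bounded r c bs (Bounded-entry bs r (suc c) ex))
  ...   | false = slides-Bounded f _ (suc r) c (setEntry-Bounded r c bs (Legal-above {x = y} (Bounded-entry bs (suc r) c ey)))

  SlidOut : Tab L → Tab L × (ℕ × ℕ) → Set
  SlidOut T (T′ , r , c) = Tableau T′ × Corner (shape T) r c × shape T′ ≡ removeFromShape (shape T) r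

  -- With less fuel than required the hole (h , k) would lie outside the diagram.
  slides-outcome : ∀ f T h k → Punctured T h k → size T ≤ f + (h + k) → SlidOut T (slides f T h k)
  slides-outcome zero T h k P sz = ⊥-elim (<⇒≱ (entry⇒< T partition h k (proj₂ hole)) sz)
    where open Punctured P
  slides-outcome (suc f) T h k P sz = slide
    where
    -- `SlidOut` depends on its first tableau only through the shape, which `setEntry` preserves.
    unset : ∀ {a res} → SlidOut (setEntry T h k a) res → SlidOut T res
    unset {a} {res} = subst (λ ps → Tableau (proj₁ res) × Corner ps (proj₁ (proj₂ res)) (proj₂ (proj₂ res))
      × shape (proj₁ res) ≡ removeFromShape ps (proj₁ (proj₂ res))) (shape-setEntry T h k a)
    -- Each slide uses one unit of fuel and raises the sum of the hole's coordinates by one.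
    fuel : ∀ a {p} → p ≡ suc (h + k) → size (setEntry T h k a) ≤ f + p
    fuel a refl = subst (_≤ f + suc (h + k)) (cong sum (sym (shape-setEntry T h k a))) (subst (size T ≤_) (sym (+-suc f (h + k))) sz)
    left : ∀ x → entry T h (suc k) ≡ just x → (∀ y → entry T (suc h) k ≡ just y → Col x y) →
      SlidOut T (slides f (setEntry T h k x) h (suc k))
    left x ex above = unset (slides-outcome f _ h (suc k) (slideLeft P ex above) (fuel x (+-suc h k)))
    up : ∀ y → entry T (suc h) k ≡ just y → (∀ x → entry T h (suc k) ≡ just x → Row y x) →
      SlidOut T (slides f (setEntry T h k y) (suc h) k)
    up y ey before = unset (slides-outcome f _ (suc h) k (slideUp P ey before) (fuel y refl))
    slide : SlidOut T (slides (suc f) T h k)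
    slide with entry T h (suc k) in ex | entry T (suc h) k in ey
    ... | nothing | nothing =
      let e = proj₂ (Punctured.hole P) ; K = entries⇒Corner T h k e ex ey in
      deleteHole P K , K , shape-deleteBox T h k e
    ... | just x  | nothing = left x ex λ _ ey′ → ⊥-elim (nothing≢just (trans (sym ey) ey′))
    ... | nothing | just y  = up y ey λ _ ex′ → ⊥-elim (nothing≢just (trans (sym ex) ex′))
    ... | just x  | just y with leftMoves x y in lm
    ...   | true  = left x ex λ _ ey′ → subst (Col x) (just-injective (trans (sym ey) ey′)) (leftMoves-true x y lm)
    ...   | false = up y ey λ _ ex′ → subst (Row y) (just-injective (trans (sym ex) ex′)) (leftMoves-false x y lm)

-- Reverse dual row insertion

module _ {A : Set} where

  shape-addBox : ∀ (T : Tab A) k a → shape (addBox T k a) ≡ addToShape (shape T) k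
  shape-addBox []        k       a = refl
  shape-addBox (row ∷ T) zero    a = cong (_∷ _) (trans (length-++ row) (+-comm _ 1))
  shape-addBox (row ∷ T) (suc k) a = cong (length row ∷_) (shape-addBox T k a)

  entry-addBox-below : ∀ (T : Tab A) k a {k′} c → k < k′ → entry (addBox T k a) k′ c ≡ entry T k′ c
  entry-addBox-below []        k       a {suc k′} c _         = refl
  entry-addBox-below (row ∷ T) zero    a {suc k′} c _         = refl
  entry-addBox-below (row ∷ T) (suc k) a {suc k′} c (s≤s k<k′) = entry-addBox-below T k a c k<k′

  entry-All : ∀ {Q : A → Set} {T} → All (All Q) T → ∀ r c {x} → entry T r c ≡ just x → Q x
  entry-All (q ∷ _)  zero    c e = at-All q c e
  entry-All (_ ∷ qs) (suc r) c e = entry-All qs r c e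

  addBox-All : ∀ {Q : A → Set} {T} k {a} → All (All Q) T → Q a → All (All Q) (addBox T k a)
  addBox-All k       []       qa = (qa ∷ []) ∷ []
  addBox-All zero    (q ∷ qs) qa = All.++⁺ q (qa ∷ []) ∷ qs
  addBox-All (suc k) (q ∷ qs) qa = q ∷ addBox-All k qs qa

  deleteBox-All : ∀ {Q : A → Set} {T} r c → All (All Q) T → All (All Q) (deleteBox T r c)
  deleteBox-All r       c []       = []
  deleteBox-All (suc r) c (q ∷ qs) = q ∷ deleteBox-All r c qs
  deleteBox-All {T = row ∷ T} zero c (q ∷ qs) with removeAt row c | removeAt-All {xs = row} c q
  ... | []    | _  = qs
  ... | _ ∷ _ | q′ = q′ ∷ qs

  Corner-entry : ∀ (T : Tab A) {r c} → Corner (shape T) r c → ∃ λ x → entry T r c ≡ just x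
  Corner-entry (row ∷ T) {zero}  {c} K = <⇒at-just row c (≤-reflexive (sym (Corner-length K)))
  Corner-entry (row ∷ T) {suc r} {c} (there K) = Corner-entry T K

module _ where

  open Recording

  Over-snoc : ∀ {row next i} → Over row next → All (_≤ i) row → length (next ++ [ i ]) ≤ length row → Over row (next ++ [ i ])
  Over-snoc {_ ∷ _} []      (x≤i ∷ _) _       = s≤s x≤i ∷ []
  Over-snoc         (c ∷ o) (_ ∷ ≤i) (s≤s l) = c ∷ Over-snoc o ≤i l

  Over-addBox : ∀ {row} T k {i} → Over row (headRow T) → All (_≤ i) row →
    length (headRow (addBox T k i)) ≤ length row → Over row (headRow (addBox T k i))
  Over-addBox []         k       o ≤i l = Over-snoc o ≤i l
  Over-addBox (next ∷ T) zero    o ≤i l = Over-snoc o ≤i l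
  Over-addBox (next ∷ T) (suc k) o ≤i l = o

  -- Columns are weak, so an `i` that is at least every entry fits under any row that is long
  -- enough. Strict inequality is asked only of the row receiving the box.
  addBox-Tableau : ∀ {T} k {i} → Tableau T → IsPartition (addToShape (shape T) k) → All (All (_≤ i)) T →
    (∀ c x → entry T k c ≡ just x → x < i) → Tableau (addBox T k i)
  addBox-Tableau k [] _ _ _ = tableau (s≤s z≤n) ([] ∷ []) [] []
  addBox-Tableau {row ∷ T} zero {i} (tableau 0<l ap o t) _ _ <i =
    tableau (≤-trans 0<l (subst (length row ≤_) (sym (length-++ row)) (m≤m+n _ _)))
      (AllPairs.++⁺ ap ([] ∷ []) (All.map (_∷ []) (All-at row <i))) (Over-++ [ i ] o) t
  addBox-Tableau {row ∷ T} (suc k) {i} (tableau 0<l ap o t) p (≤i ∷ ≤is) <i =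
    tableau 0<l ap (Over-addBox T k o ≤i len) (addBox-Tableau k t (partition-tail p) ≤is <i)
    where
    len : length (headRow (addBox T k i)) ≤ length row
    len = subst (_≤ length row) (trans (cong head₀ (sym (shape-addBox T k i))) (head₀-shape (addBox T k i))) (partition-head p)

  -- The rightmost entry at most `x` is replaced; in a strictly increasing row this is the largest
  -- one.
  data Replace (x : ℕ) : List ℕ → List ℕ → ℕ → Set where
    here  : ∀ {b ys} → b ≤ x → All (x <_) ys → Replace x (b ∷ ys) (x ∷ ys) b
    there : ∀ {y ys ys′ b} → Replace x ys ys′ b → Replace x (y ∷ ys) (y ∷ ys′) b

  replaceLE-nothing : ∀ row x → replaceLE row x ≡ nothing → All (x <_) row
  replaceLE-nothing []        x e = []
  replaceLE-nothing (y ∷ row) x e with replaceLE row x in eq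
  ... | nothing with y ≤ᵇ x in b
  ...   | false = ≤ᵇ-false y x b ∷ replaceLE-nothing row x eq

  replaceLE-just : ∀ row x {row′ b} → replaceLE row x ≡ just (row′ , b) → Replace x row row′ b
  replaceLE-just (y ∷ row) x e with replaceLE row x in eq
  replaceLE-just (y ∷ row) x refl | just _  = there (replaceLE-just row x eq)
  replaceLE-just (y ∷ row) x e    | nothing with y ≤ᵇ x in b
  replaceLE-just (y ∷ row) x refl | nothing | true = here (≤ᵇ-true y x b) (replaceLE-nothing row x eq)

  Replace-≤ : ∀ {x row row′ b} → Replace x row row′ b → b ≤ x
  Replace-≤ (here b≤x _) = b≤x
  Replace-≤ (there rp)   = Replace-≤ rp

  Replace-All : ∀ {Q : ℕ → Set} {x row row′ b} → Replace x row row′ b → Q x → All Q row → All Q row′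
  Replace-All (here _ _)  qx (_ ∷ qs) = qx ∷ qs
  Replace-All (there rp)  qx (q ∷ qs) = q ∷ Replace-All rp qx qs

  Replace-All-replaced : ∀ {Q : ℕ → Set} {x row row′ b} → Replace x row row′ b → All Q row → Q b
  Replace-All-replaced (here _ _) (q ∷ _)  = q
  Replace-All-replaced (there rp) (_ ∷ qs) = Replace-All-replaced rp qs

  Replace-AllPairs : ∀ {x row row′ b} → Replace x row row′ b → AllPairs Row row → AllPairs Row row′
  Replace-AllPairs (here _ x<) (_ ∷ ap) = x< ∷ ap
  Replace-AllPairs (there rp)  (q ∷ ap) =
    Replace-All rp (<-≤-trans (Replace-All-replaced rp q) (Replace-≤ rp)) q ∷ Replace-AllPairs rp ap

  Replace-length : ∀ {x row row′ b} → Replace x row row′ b → length row′ ≡ length row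
  Replace-length (here _ _) = refl
  Replace-length (there rp) = cong suc (Replace-length rp)

  data Last (x : ℕ) : List ℕ → List ℕ → Set where
    last  : Last x [ x ] []
    there : ∀ {y ys ys′} → Last x ys ys′ → Last x (y ∷ ys) (y ∷ ys′)

  removeAt-Last : ∀ row c {x} → length row ≡ suc c → at row c ≡ just x → Last x row (removeAt row c)
  removeAt-Last (_ ∷ [])  zero    l refl = last
  removeAt-Last (_ ∷ row) (suc c) l e    = there (removeAt-Last row c (suc-injective l) e)

  -- The entry directly above `x` is at most `x`. So the first upward step of reverse bumping always
  -- finds something to replace; `Replace-above` does the same for later steps.
  Last-above : ∀ {x row next next′} → Last x next next′ → Over row next → ¬ All (x <_) row
  Last-above last       (yx ∷ _) (x<y ∷ _) = <⇒≱ yx x<y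
  Last-above (there lt) (_ ∷ o)  (_ ∷ x<)  = Last-above lt o x<

  Replace-above : ∀ {x row next next′ a} → Replace x next next′ a → Over row next → ¬ All (a <_) row
  Replace-above (here _ _) (ya ∷ _) (a<y ∷ _) = <⇒≱ ya a<y
  Replace-above (there rp) (_ ∷ o)  (_ ∷ a<)  = Replace-above rp o a<

  Over-Replace-above : ∀ {a row row′ next b} → All (a <_) next → Over row next → Replace a row row′ b → Over row′ next
  Over-Replace-above a<          []      rp         = []
  Over-Replace-above (a<u ∷ _)   (_ ∷ o) (here _ _) = m<n⇒m<1+n a<u ∷ o
  Over-Replace-above (_ ∷ a<)    (c ∷ o) (there rp) = c ∷ Over-Replace-above a< o rp

  Over-Last-Replace : ∀ {x row row′ next next′ b} → Last x next next′ → Over row next → Replace x row row′ b → Over row′ next′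
  Over-Last-Replace last       o       rp          = []
  Over-Last-Replace (there lt) (_ ∷ o) (here _ x<) = ⊥-elim (Last-above lt o x<)
  Over-Last-Replace (there lt) (c ∷ o) (there rp)  = c ∷ Over-Last-Replace lt o rp

  -- An entry bumped out of column c lands weakly right of c in the row above.
  Over-Replace-Replace : ∀ {x row row′ next next′ a b} → Replace x next next′ a → Over row next →
    Replace a row row′ b → Over row′ next′
  Over-Replace-Replace (here a≤x _)  (_ ∷ o)  (here _ _)  = s≤s a≤x ∷ o
  Over-Replace-Replace (here a≤x x<) (ya ∷ o) (there rp)  =
    ≤-trans ya (s≤s a≤x) ∷ Over-Replace-above (All.map (≤-<-trans a≤x) x<) o rp
  Over-Replace-Replace (there rq)    (_ ∷ o)  (here _ a<) = ⊥-elim (Replace-above rq o a<)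
  Over-Replace-Replace (there rq)    (c ∷ o)  (there rp)  = c ∷ Over-Replace-Replace rq o rp

  -- The last two fields speak of an arbitrary row placed on `P`: the ejected `a` can replace an
  -- entry there, and the outcome still fits. With them the induction on rows need not know where
  -- the bumping path ran. The field `all` passes any bound on the entries of `P` to the new tableau
  -- and to `a`.
  record Unbumped (P : Tab ℕ) (r : ℕ) (P′ : Tab ℕ) (a : ℕ) : Set₁ where
    field
      isTableau : Tableau P′
      newShape  : shape P′ ≡ removeFromShape (shape P) r
      all       : ∀ {Q : ℕ → Set} → All (All Q) P → All (All Q) P′ × Q a
      above-≤   : ∀ {row} → Over row (headRow P) → ¬ All (a <_) row
      above     : ∀ {row row′ b} → Over row (headRow P) → Replace a row row′ b → Over row′ (headRow P′)

  headRow-deleteBox : ∀ row P c {x} → IsPartition (shape (row ∷ P)) → Corner (shape (row ∷ P)) 0 c → at row c ≡ just x →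
    headRow (deleteBox (row ∷ P) 0 c) ≡ removeAt row c
  headRow-deleteBox row P c p K e with removeAt row c | length-removeAt row c e
  ... | _ ∷ _ | _ = refl
  ... | []    | l rewrite l with K
  ...   | here h = empty P (partition-head-0 (partition-tail p) h)
    where
    empty : ∀ P → shape P ≡ [] → headRow P ≡ []
    empty [] _ = refl

  -- `revDualInsert` cuts the tableau at row `r`. This equation turns it into a recursion on rows:
  -- whatever leaves the lower rows is placed in the top row.
  revDualInsert-∷ : ∀ row P r c {x row′ b} → entry P r c ≡ just x →
    replaceLE row (proj₂ (revDualInsert P r c)) ≡ just (row′ , b) →
    revDualInsert (row ∷ P) (suc r) c ≡ (row′ ∷ proj₁ (revDualInsert P r c) , b)
  revDualInsert-∷ row P r c {x} e eq rewrite e with revBumpUp (take r P) x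
  ... | T′ , x₁ rewrite eq = refl

  revDualInsert-top : ∀ row P c {x} → at row c ≡ just x → revDualInsert (row ∷ P) 0 c ≡ (deleteBox (row ∷ P) 0 c , x)
  revDualInsert-top row P c e rewrite e = refl

  revDualInsert-outcome : ∀ {P r c} → Tableau P → Corner (shape P) r c →
    Unbumped P r (proj₁ (revDualInsert P r c)) (proj₂ (revDualInsert P r c))
  revDualInsert-outcome {row ∷ P} {zero} {c} t K with Corner-entry (row ∷ P) K
  ... | x , e rewrite revDualInsert-top row P c e = record
    { isTableau = deleteHole (puncture 0 c t e) K
    ; newShape  = shape-deleteBox (row ∷ P) 0 c e
    ; all       = λ qs → deleteBox-All 0 c qs , entry-All qs 0 c e
    ; above-≤   = Last-above (removeAt-Last row c (Corner-length K) e)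
    ; above     = λ o rp → subst (Over _) (sym (headRow-deleteBox row P c (Tableau⇒partition t) K e))
                    (Over-Last-Replace (removeAt-Last row c (Corner-length K) e) o rp)
    }
  revDualInsert-outcome {row ∷ P} {suc r} {c} (tableau 0<l ap o t) (there K)
    with replaceLE row (proj₂ (revDualInsert P r c)) in eq
  ... | nothing = ⊥-elim (Unbumped.above-≤ (revDualInsert-outcome t K) o (replaceLE-nothing row _ eq))
  ... | just (row′ , b) rewrite revDualInsert-∷ row P r c (proj₂ (Corner-entry P K)) eq = record
    { isTableau = tableau (subst (0 <_) (sym (Replace-length rp)) 0<l) (Replace-AllPairs rp ap) (above o rp) isTableau
    ; newShape  = trans (cong₂ _∷_ (Replace-length rp) newShape) (sym (removeFromShape-suc (length row) (shape P) r))
    ; all       = λ { (q ∷ qs) → let qs′ , qa = all qs in Replace-All rp qa q ∷ qs′ , Replace-All-replaced rp q }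
    ; above-≤   = Replace-above rp
    ; above     = Over-Replace-Replace rp
    }
    where
    rp = replaceLE-just row _ eq
    open Unbumped (revDualInsert-outcome t K)

-- Transposition

module _ {A : Set} where

  private
    tail-at-nothing : ∀ (row : List A) T c → IsPartition (shape (row ∷ T)) → at row c ≡ nothing → ∀ r → entry T r c ≡ nothing
    tail-at-nothing row T c p e r with entry T r c in eq
    ... | nothing = refl
    ... | just y  = ⊥-elim (nothing≢just (trans (sym e) (proj₂ (entry-closed (row ∷ T) p {zero} {suc r} z≤n ≤-refl eq))))

  -- `column` skips rows that are too short. In a partition shape all of them lie at the bottom, so
  -- no row index shifts.
  at-column : ∀ (T : Tab A) c → IsPartition (shape T) → ∀ r → at (column c T) r ≡ entry T r c
  at-column []        c p r = refl
  at-column (row ∷ T) c p r with at row c in e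
  at-column (row ∷ T) c p zero    | just x  = sym e
  at-column (row ∷ T) c p (suc r) | just x  = at-column T c (partition-tail p) r
  at-column (row ∷ T) c p zero    | nothing =
    trans (at-column T c (partition-tail p) 0) (trans (tail-at-nothing row T c p e 0) (sym e))
  at-column (row ∷ T) c p (suc r) | nothing =
    trans (at-column T c (partition-tail p) (suc r)) (trans (tail-at-nothing row T c p e (suc r)) (sym (tail-at-nothing row T c p e r)))

  entry-applyUpTo : ∀ (f : ℕ → List A) l c r {x} → entry (applyUpTo f l) c r ≡ just x → at (f c) r ≡ just x
  entry-applyUpTo f (suc l) zero    r e = e
  entry-applyUpTo f (suc l) (suc c) r e = entry-applyUpTo (f ∘ suc) l c r e

  entry-transpose : ∀ (T : Tab A) → IsPartition (shape T) → ∀ c r {x} → entry (transpose T) c r ≡ just x → entry T r c ≡ just x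
  entry-transpose T@(row ∷ _) p c r e = trans (sym (at-column T c p r))
    (entry-applyUpTo (λ c → column c T) (length row) c r (trans (cong (λ U → entry U c r) (sym (map-upTo (λ c → column c T) (length row)))) e))

  length-column : ∀ c (T : Tab A) → length (column c T) ≡ length (filter (λ p → c <? p) (shape T))
  length-column c [] = refl
  length-column c (row ∷ T) with at row c in e
  ... | just _  = trans (cong suc (length-column c T))
    (sym (cong length (filter-accept (c <?_) {xs = shape T} (at-just⇒< row c e))))
  ... | nothing = trans (length-column c T)
    (sym (cong length (filter-reject (c <?_) {xs = shape T} λ c<l → nothing≢just (trans (sym e) (proj₂ (<⇒at-just row c c<l))))))

  length-column-suc : ∀ c (T : Tab A) → length (column (suc c) T) ≤ length (column c T)
  length-column-suc c [] = z≤n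
  length-column-suc c (row ∷ T) with at row (suc c) in e′ | at row c in e
  ... | just _  | just _  = s≤s (length-column-suc c T)
  ... | nothing | just _  = m≤n⇒m≤1+n (length-column-suc c T)
  ... | nothing | nothing = length-column-suc c T
  ... | just _  | nothing = ⊥-elim (nothing≢just (trans (sym e) (proj₂ (<⇒at-just row c (<-trans ≤-refl (at-just⇒< row (suc c) e′))))))

  shape-transpose : ∀ (T : Tab A) → shape (transpose T) ≡ conj (shape T)
  shape-transpose []          = refl
  shape-transpose T@(row ∷ _) = trans (sym (map-∘ (upTo (length row)))) (map-cong (λ c → length-column c T) (upTo (length row)))

  applyUpTo-partition : ∀ (g : ℕ → ℕ) l → (∀ c → c < l → 1 ≤ g c) → (∀ c → g (suc c) ≤ g c) → IsPartition (applyUpTo g l)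
  applyUpTo-partition g zero          pos dec = []ᵖ
  applyUpTo-partition g (suc zero)    pos dec = [ pos 0 ≤-refl ]ᵖ
  applyUpTo-partition g (suc (suc l)) pos dec =
    consᵖ (dec 0) (applyUpTo-partition (g ∘ suc) (suc l) (λ c c<l → pos (suc c) (s≤s c<l)) (dec ∘ suc))

  transpose-partition : ∀ (T : Tab A) → IsPartition (shape (transpose T))
  transpose-partition []          = []ᵖ
  transpose-partition T@(row ∷ T′) = subst IsPartition
    (trans (sym (map-upTo (λ c → length (column c T)) (length row))) (map-∘ (upTo (length row))))
    (applyUpTo-partition (λ c → length (column c T)) (length row) positive (λ c → length-column-suc c T))
    where
    positive : ∀ c → c < length row → 1 ≤ length (column c T)
    positive c c<l with at row c | <⇒at-just row c c<l
    ... | just _ | _ = s≤s z≤n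

transpose-semistandard : ∀ {P} → Recording.Tableau P → Semistandard (transpose P)
transpose-semistandard {P} t = record
  { partitionShape = transpose-partition P
  ; rowWeak   = λ r c x y ex ey → ≤-pred (Recording.Tableau-cols t r ≤-refl (entry-P r c ex) (entry-P r (suc c) ey))
  ; colStrict = λ r c x y ex ey → Recording.Tableau-rows t c ≤-refl (entry-P r c ex) (entry-P (suc r) c ey)
  }
  where
  entry-P = entry-transpose P (Recording.Tableau⇒partition t)

-- Reordering the bottom entries

-- The successor in the bound for `bs` makes the tops of distinct blocks different, so the condition
-- of `ColOrderB` on equal tops never compares two blocks.
data Blocks (l : ℕ) : List (List (ℕ × ℕ)) → Set where
  []    : Blocks l []
  block : ∀ {p ps bs} → l ≤ proj₁ p → All (λ p′ → proj₁ p′ ≡ proj₁ p) ps → Blocks (suc (proj₁ p)) bs → Blocks l ((p ∷ ps) ∷ bs)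

blocks-Blocks : ∀ {l} ps → All (λ p → l ≤ proj₁ p) ps → AllPairs (λ p p′ → proj₁ p ≤ proj₁ p′) ps → Blocks l (blocks ps)
blocks-Blocks []       _         _        = []
blocks-Blocks (p ∷ ps) (l≤p ∷ _) (q ∷ qs) with blocks ps | blocks-Blocks ps q qs
... | [] | [] = block l≤p [] []
... | (p′ ∷ _) ∷ _ | block p≤p′ same bs with proj₁ p ≡ᵇ proj₁ p′ in eq
...   | false = block l≤p [] (block (≤∧≢⇒< p≤p′ λ e → subst T eq (≡⇒≡ᵇ _ _ e)) same bs)
...   | true with ≡ᵇ-true (proj₁ p) (proj₁ p′) eq
...     | e = block l≤p (sym e ∷ All.map (λ e′ → trans e′ (sym e)) same) (subst (λ t → Blocks (suc t) _) (sym e) bs)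

blocks-All : ∀ {Q : ℕ × ℕ → Set} {ps} → All Q ps → All (All Q) (blocks ps)
blocks-All [] = []
blocks-All {ps = p ∷ ps} (q ∷ qs) with blocks ps | blocks-All qs
... | []             | _ = (q ∷ []) ∷ []
... | [] ∷ _         | bs = (q ∷ []) ∷ bs
... | (p′ ∷ _) ∷ _   | b ∷ bs with proj₁ p ≡ᵇ proj₁ p′
...   | true  = (q ∷ b) ∷ bs
...   | false = (q ∷ []) ∷ b ∷ bs

insertDesc-All : ∀ {Q : ℕ × ℕ → Set} {p ps} → Q p → All Q ps → All Q (insertDesc p ps)
insertDesc-All q [] = q ∷ []
insertDesc-All {p = p} {p′ ∷ _} q (q′ ∷ qs) with proj₂ p′ ≤ᵇ proj₂ p
... | true  = q ∷ q′ ∷ qs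
... | false = q′ ∷ insertDesc-All q qs

sortDesc-All : ∀ {Q : ℕ × ℕ → Set} {ps} → All Q ps → All Q (sortDesc ps)
sortDesc-All []       = []
sortDesc-All (q ∷ qs) = insertDesc-All q (sortDesc-All qs)

Desc : ℕ × ℕ → ℕ × ℕ → Set
Desc p p′ = proj₂ p′ ≤ proj₂ p

insertDesc-Desc : ∀ p {ps} → AllPairs Desc ps → AllPairs Desc (insertDesc p ps)
insertDesc-Desc p [] = [] ∷ []
insertDesc-Desc p {p′ ∷ _} (q ∷ qs) with proj₂ p′ ≤ᵇ proj₂ p in eq
... | true  = (≤ᵇ-true _ _ eq ∷ All.map (λ r → ≤-trans r (≤ᵇ-true _ _ eq)) q) ∷ q ∷ qs
... | false = insertDesc-All (<⇒≤ (≤ᵇ-false (proj₂ p′) (proj₂ p) eq)) q ∷ insertDesc-Desc p qs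

sortDesc-Desc : ∀ ps → AllPairs Desc (sortDesc ps)
sortDesc-Desc []       = []
sortDesc-Desc (p ∷ ps) = insertDesc-Desc p (sortDesc-Desc ps)

constant-top : ∀ {t ps} → All (λ p → proj₁ p ≡ t) ps → AllPairs Desc ps → AllPairs ColOrderB ps
constant-top []       []       = []
constant-top (e ∷ es) (d ∷ ds) =
  All.zipWith (λ (e′ , d′) → ≤-reflexive (trans e (sym e′)) , λ _ → d′) (es , d) ∷ constant-top es ds

Blocks-sorted : ∀ {l bs} → Blocks l bs →
  All (λ p → l ≤ proj₁ p) (concat (map sortDesc bs)) × AllPairs ColOrderB (concat (map sortDesc bs))
Blocks-sorted [] = [] , []
Blocks-sorted {l} (block {p} {ps} l≤p same bs) with Blocks-sorted bs
... | lower , sorted =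
    All.++⁺ (All.map (λ e → ≤-trans l≤p (≤-reflexive (sym e))) tops) (All.map (λ p<t → ≤-trans l≤p (<⇒≤ p<t)) lower)
  , AllPairs.++⁺ (constant-top tops (sortDesc-Desc (p ∷ ps))) sorted
      (All.map (λ e → All.map (λ p<t → <⇒≤ (≤-<-trans (≤-reflexive e) p<t) , λ e′ → ⊥-elim (<⇒≢ p<t (trans (sym e) e′))) lower) tops)
  where
  tops : All (λ p′ → proj₁ p′ ≡ proj₁ p) (sortDesc (p ∷ ps))
  tops = sortDesc-All (refl ∷ same)

reorder-sorted : ∀ {ps} → AllPairs (λ p p′ → proj₁ p ≤ proj₁ p′) ps → AllPairs ColOrderB (reorder ps)
reorder-sorted {ps} s = proj₂ (Blocks-sorted (blocks-Blocks {0} ps (All.universal (λ _ → z≤n) ps) s))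

-- Tops agree within a block, so sorting its bottom entries amounts to permuting whole columns, and
-- properties of single columns survive.
reorder-All : ∀ {Q : ℕ × ℕ → Set} {ps} → All Q ps → All Q (reorder ps)
reorder-All qs = All.concat⁺ (All.map⁺ (All.map sortDesc-All (blocks-All qs)))

AllPairs⇒SortedBy : ∀ {A : Set} {R : A → A → Set} {xs} → AllPairs R xs → SortedBy R xs
AllPairs⇒SortedBy []                    = nil
AllPairs⇒SortedBy (_ ∷ [])              = one
AllPairs⇒SortedBy ((r ∷ _) ∷ ap@(_ ∷ _)) = cons r (AllPairs⇒SortedBy ap)

-- The invariant of the correspondence

module _ {m n : ℕ} where

  open Spo {m} {n}

  private
    L = Letter m n

  IsB0-≤ : ∀ {x y : L} → hiRank x ≤ rank y → IsB0 y → IsB0 x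
  IsB0-≤ {plain i}  _   _ = plainB0 i
  IsB0-≤ {barred i} _   _ = barredB0 i
  IsB0-≤ {circ j}   x≤y b = ⊥-elim (<-asym x≤y (rank-B0<circ b j))

  IsB0-Col : ∀ {x y : L} → Col x y → IsB0 y → IsB0 x
  IsB0-Col {plain i}  _   _ = plainB0 i
  IsB0-Col {barred i} _   _ = barredB0 i
  IsB0-Col {circ j} {plain i}  x<y b = ⊥-elim (<-asym x<y (rank-B0<circ b j))
  IsB0-Col {circ j} {barred i} x<y b = ⊥-elim (<-asym x<y (rank-B0<circ b j))

  B0-Col⇒< : ∀ {x y : L} → Col x y → IsB0 y → rank x < rank y
  B0-Col⇒< x<y (plainB0 _)  = x<y
  B0-Col⇒< x<y (barredB0 _) = x<y

  Tableau⇒SpoTableau : ∀ {T : Tab L} → Tableau T → Bounded 0 T → SpoTableau T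
  Tableau⇒SpoTableau {T} t bs = record
    { partitionShape = Tableau⇒partition t
    ; b0LeftClosed = λ r c x y ex ey → IsB0-≤ {x} {y} (row r c ex ey)
    ; b0UpClosed   = λ r c x y ex ey → IsB0-Col {x} {y} (col r c ex ey)
    ; b0RowWeak    = λ r c x y ex ey _ _ → ≤-trans (rank≤hiRank x) (row r c ex ey)
    ; b0ColStrict  = λ r c x y ex ey _ b → B0-Col⇒< {x} {y} (col r c ex ey) b
    ; b0RowBound   = λ r c x ex → subst (λ s → Legal s x) (+-identityʳ r) (Bounded-entry bs r c ex)
    ; b1RowStrict  = λ { r c x y ex ey (circB1 _) _ → row r c ex ey }
    ; b1ColWeak    = λ { r c x y ex ey _ (circB1 _) → ≤-pred (col r c ex ey) }
    }
    where
    row : ∀ r c {x y} → entry T r c ≡ just x → entry T r (suc c) ≡ just y → Row x y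
    row r c = Tableau-rows t r ≤-refl
    col : ∀ r c {x y} → entry T r c ≡ just x → entry T (suc r) c ≡ just y → Col x y
    col r c = Tableau-cols t c ≤-refl

  rank-injective : ∀ (x y : L) → rank x ≡ rank y → x ≡ y
  rank-injective (plain i)  (plain k)  e = cong plain (toℕ-injective (*-cancelˡ-≡ (toℕ i) (toℕ k) 2 e))
  rank-injective (plain i)  (barred k) e = ⊥-elim (even≢odd (toℕ i) (toℕ k) e)
  rank-injective (plain i)  (circ k)   e = ⊥-elim (<⇒≢ (rank-B0<circ (plainB0 i) k) e)
  rank-injective (barred i) (plain k)  e = ⊥-elim (even≢odd (toℕ k) (toℕ i) (sym e))
  rank-injective (barred i) (barred k) e = cong barred (toℕ-injective (*-cancelˡ-≡ (toℕ i) (toℕ k) 2 (suc-injective e)))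
  rank-injective (barred i) (circ k)   e = ⊥-elim (<⇒≢ (rank-B0<circ (barredB0 i) k) e)
  rank-injective (circ j)   (plain k)  e = ⊥-elim (<⇒≢ (rank-B0<circ (plainB0 k) j) (sym e))
  rank-injective (circ j)   (barred k) e = ⊥-elim (<⇒≢ (rank-B0<circ (barredB0 k) j) (sym e))
  rank-injective (circ j)   (circ k)   e = cong circ (toℕ-injective (+-cancelˡ-≡ (2 * m) (toℕ j) (toℕ k) e))

  Follows : ℕ × L → ℕ × L → Set
  Follows (i , j) (i′ , j′) = i ≤ i′ × (i ≡ i′ → Col j′ j)

  -- For `j` in B₁ the weak order on bottom letters already is `Col`. For `j` in B₀ equality must be
  -- excluded: by injectivity of `rank` it would repeat a column with a letter of B₀.
  AStar-Follows : ∀ {p p′ : ℕ × L} → ColOrderA p p′ → (p ≡ p′ → IsB1 (proj₂ p)) → Follows p p′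
  AStar-Follows {i , j} {_ , j′} (i≤i′ , ord) once = i≤i′ , λ { refl → strict j j′ (ord refl) λ e → once (cong (i ,_) e) }
    where
    strict : ∀ j j′ → rank j′ ≤ rank j → (j ≡ j′ → IsB1 j) → Col j′ j
    strict (circ _) j′ j′≤j once = s≤s j′≤j
    strict j@(plain _) j′ j′≤j once = ≤∧≢⇒< j′≤j λ e → B0≢B1 (once (sym (rank-injective j′ j e)))
      where
      B0≢B1 : ∀ {i} → IsB1 {m} {n} (plain i) → ⊥
      B0≢B1 ()
    strict j@(barred _) j′ j′≤j once = ≤∧≢⇒< j′≤j λ e → B0≢B1 (once (sym (rank-injective j′ j e)))
      where
      B0≢B1 : ∀ {i} → IsB1 {m} {n} (barred i) → ⊥
      B0≢B1 ()

  AStar⇒SortedBy-Follows : ∀ {π : List (ℕ × L)} → SortedBy ColOrderA π → AllPairs (λ p p′ → p ≡ p′ → IsB1 (proj₂ p)) π → SortedBy Follows π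
  AStar⇒SortedBy-Follows nil        _              = nil
  AStar⇒SortedBy-Follows one        _              = one
  AStar⇒SortedBy-Follows (cons {x} {y} r s) ((q ∷ _) ∷ qs) = cons (AStar-Follows {x} {y} r q) (AStar⇒SortedBy-Follows s qs)

  -- Here `t` bounds all top entries read so far, hence all entries of `P`. An entry ejected while
  -- reading `i ≥ t` is therefore at most `i`, which gives the last condition on `L`.
  record Invariant (q : ℕ) (st : State {m} {n}) (t : ℕ) : Set where
    field
      tableau₁  : Tableau (proj₁ st)
      bounded   : Bounded 0 (proj₁ st)
      sameShape : shape (proj₁ (proj₂ st)) ≡ shape (proj₁ st)
      tableau₂  : Recording.Tableau (proj₁ (proj₂ st))
      entries   : All (All (λ x → (1 ≤ x × x ≤ q) × x ≤ t)) (proj₁ (proj₂ st))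
      columns   : All (λ p → ((1 ≤ proj₁ p × proj₁ p ≤ q) × (1 ≤ proj₂ p × proj₂ p ≤ q)) × proj₂ p ≤ proj₁ p × proj₁ p ≤ t) (proj₂ (proj₂ st))
      topSorted : AllPairs (λ p p′ → proj₁ p ≤ proj₁ p′) (proj₂ (proj₂ st))

  -- All rows from `k` on are included, not just row `k`, so that the property survives an addition:
  -- the next box of the block goes further down, into rows that `addBox` has not touched.
  Ready : State {m} {n} → ℕ × L → Set
  Ready (Pt , P , _) (i , j) = ∀ {T′ k} → Added 0 j Pt T′ k → ∀ {k′} → k ≤ k′ → ∀ c x → entry P k′ c ≡ just x → x < i

  step-added : ∀ Pt P Ls i j {T′ r c} → insRows 0 j Pt ≡ added T′ r c →
    step {m} {n} (Pt , P , Ls) (i , j) ≡ (T′ , addBox P r i , Ls)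
  step-added Pt P Ls i j e rewrite e = refl

  step-cancelled : ∀ Pt P Ls i j {T′ r c} → insRows 0 j Pt ≡ cancelled T′ r c →
    let T″ , r′ , c′ = slides (suc (size T′)) T′ r c ; P′ , a = revDualInsert P r′ c′ in
    step {m} {n} (Pt , P , Ls) (i , j) ≡ (T″ , P′ , Ls ++ [ (i , a) ])
  step-cancelled Pt P Ls i j e rewrite e = refl

  Legal-0 : ∀ (z : L) → Legal 0 z
  Legal-0 _ (plainB0 _)  = s≤s z≤n
  Legal-0 _ (barredB0 _) = s≤s z≤n

  -- For a new top entry i′ > i every entry of P is smaller than i′; only a repeated top entry needs care.
  Ready-next : ∀ {q st i j} → Invariant q st i →
    (∀ {j′ T′ k} → Col j′ j → Added 0 j′ (proj₁ st) T′ k → ∀ {k′} → k ≤ k′ → ∀ c x → entry (proj₁ (proj₂ st)) k′ c ≡ just x → x < i) →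
    ∀ {p′} → Follows (i , j) p′ → Ready st p′
  Ready-next inv same (i≤i′ , col) a k≤k′ c x e with m≤n⇒m<n∨m≡n i≤i′
  ... | inj₁ i<i′ = ≤-<-trans (proj₂ (entry-All (Invariant.entries inv) _ c e)) i<i′
  ... | inj₂ refl = same (col refl) a k≤k′ c x e

  step-Invariant : ∀ {q st t i j} → Invariant q st t → t ≤ i → 1 ≤ i × i ≤ q → Ready st (i , j) →
    Invariant q (step st (i , j)) i × (∀ {p′} → Follows (i , j) p′ → Ready (step st (i , j)) p′)
  step-Invariant {q} {Pt , P , Ls} {t} {i} {j} inv t≤i range ready with insRows-outcome 0 j Pt
  ... | inj₁ (T′ , k , d , eq , a) rewrite step-added Pt P Ls i j eq | +-identityʳ k = inv′ , Ready-next {j = j} inv′ same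
    where
    open Invariant inv
    shapes : addToShape (shape P) k ≡ shape T′
    shapes = trans (cong (λ ps → addToShape ps k) sameShape) (sym (Added-shape a))
    newTableau : Tableau T′
    newTableau = Added-Tableau a tableau₁
    entries′ : All (All (λ x → (1 ≤ x × x ≤ q) × x ≤ i)) P
    entries′ = All.map (All.map (λ (r , x≤t) → r , ≤-trans x≤t t≤i)) entries
    inv′ : Invariant q (T′ , addBox P k i , Ls) i
    inv′ = record
      { tableau₁  = newTableau
      ; bounded   = Added-Bounded a bounded (Legal-0 j)
      ; sameShape = trans (shape-addBox P k i) shapes
      ; tableau₂  = addBox-Tableau k tableau₂ (subst IsPartition (sym shapes) (Tableau⇒partition newTableau))
                      (All.map (All.map proj₂) entries′) (ready a ≤-refl)
      ; entries   = addBox-All k entries′ (range , ≤-refl)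
      ; columns   = All.map (λ (r , l , p≤t) → r , l , ≤-trans p≤t t≤i) columns
      ; topSorted = topSorted
      }
    same : ∀ {j′ T″ k″} → Col j′ j → Added 0 j′ T′ T″ k″ → ∀ {k′} → k″ ≤ k′ → ∀ c x → entry (addBox P k i) k′ c ≡ just x → x < i
    same {j′} lt a′ {k′} k″≤k′ c x e with <-≤-trans (Added-Added {z′ = j′} a lt a′) k″≤k′
    ... | k<k′ = ready a (<⇒≤ k<k′) c x (trans (sym (entry-addBox-below P k i c k<k′)) e)
  ... | inj₂ (T′ , k , d , eq , a) rewrite step-cancelled Pt P Ls i j eq | +-identityʳ k = inv′ , Ready-next {j = j} inv′ same
    where
    open Invariant inv
    slid = slides (suc (size T′)) T′ k d
    r = proj₁ (proj₂ slid)
    c = proj₂ (proj₂ slid)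
    newTableau : Tableau T′
    newTableau = Cancelled-Tableau a tableau₁
    slid-ok : SlidOut T′ slid
    slid-ok = slides-outcome (suc (size T′)) T′ k d (puncture k d newTableau (proj₂ (Cancelled-hole a)))
      (≤-trans (n≤1+n _) (m≤m+n _ _))
    shapes : shape T′ ≡ shape P
    shapes = trans (Cancelled-shape a) (sym sameShape)
    open Unbumped (revDualInsert-outcome tableau₂ (subst (λ ps → Corner ps r c) shapes (proj₁ (proj₂ slid-ok))))
    P′ = proj₁ (revDualInsert P r c)
    b = proj₂ (revDualInsert P r c)
    entries′ : All (All (λ x → (1 ≤ x × x ≤ q) × x ≤ i)) P′ × ((1 ≤ b × b ≤ q) × b ≤ i)
    entries′ = all (All.map (All.map (λ (r , x≤t) → r , ≤-trans x≤t t≤i)) entries)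
    inv′ : Invariant q (proj₁ slid , P′ , Ls ++ [ (i , b) ]) i
    inv′ = record
      { tableau₁  = proj₁ slid-ok
      ; bounded   = slides-Bounded (suc (size T′)) T′ k d (Cancelled-Bounded a bounded (Legal-0 j))
      ; sameShape = trans newShape (trans (cong (λ ps → removeFromShape ps r) (sym shapes)) (sym (proj₂ (proj₂ slid-ok))))
      ; tableau₂  = isTableau
      ; entries   = proj₁ entries′
      ; columns   = All.++⁺ (All.map (λ (r , l , p≤t) → r , l , ≤-trans p≤t t≤i) columns)
                      (((range , proj₁ (proj₂ entries′)) , proj₂ (proj₂ entries′) , ≤-refl) ∷ [])
      ; topSorted = AllPairs.++⁺ topSorted ([] ∷ []) (All.map (λ (_ , _ , p≤t) → ≤-trans p≤t t≤i ∷ []) columns)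
      }
    same : ∀ {j′ T″ k″} → Col j′ j → Added 0 j′ (proj₁ slid) T″ k″ → ∀ {k′} → k″ ≤ k′ → ∀ c x → entry P′ k′ c ≡ just x → x < i
    -- Nothing has to be known about the positions of `i` in `P′`, because an addition is impossible
    -- here.
    same {j′} lt a′ = ⊥-elim (Cancelled-not-Added a (suc (size T′)) {z′ = j′} bounded (Legal-0 j) (Legal-0 j′) lt a′)

  run-Invariant : ∀ {q st t} p π → Invariant q st t → t ≤ proj₁ p → Ready st p →
    All (λ p → 1 ≤ proj₁ p × proj₁ p ≤ q) (p ∷ π) → SortedBy Follows (p ∷ π) → ∃ λ t′ → Invariant q (run st (p ∷ π)) t′
  run-Invariant p []       inv t≤ ready (r ∷ _)  _          = _ , proj₁ (step-Invariant inv t≤ r ready)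
  run-Invariant p (p′ ∷ π) inv t≤ ready (r ∷ rs) (cons f s) with step-Invariant inv t≤ r ready
  ... | inv′ , ready′ = run-Invariant p′ π inv′ (proj₁ f) (ready′ {p′} f) rs s

  empty-Invariant : ∀ {q} → Invariant q ([] , [] , []) 0
  empty-Invariant = record
    { tableau₁ = [] ; bounded = [] ; sameShape = refl ; tableau₂ = Recording.[] ; entries = [] ; columns = [] ; topSorted = [] }

  run-AStar : ∀ {q} (π : List (ℕ × L)) → InAStar q π → ∃ λ t → Invariant q (run ([] , [] , []) π) t
  run-AStar []      _ = 0 , empty-Invariant
  run-AStar (p ∷ π) h = run-Invariant p π empty-Invariant z≤n (λ _ _ _ _ ())
    (InAStar.topRange h) (AStar⇒SortedBy-Follows (InAStar.ordered h) (InAStar.b0Once h))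

theorem5p4 : (m n q : ℕ) → 1 ≤ m → 1 ≤ n → 1 ≤ q →
    (π : List (ℕ × Letter m n)) → InAStar q π →
    SpoTableau (proj₁ (dualSpo π))
    × shape (proj₁ (proj₂ (dualSpo π))) ≡ shape (proj₁ (dualSpo π))
    × Semistandard (transpose (proj₁ (proj₂ (dualSpo π))))
    × shape (transpose (proj₁ (proj₂ (dualSpo π)))) ≡ conj (shape (proj₁ (dualSpo π)))
    × EntriesIn q (proj₁ (proj₂ (dualSpo π)))
    × DualBurge q (proj₂ (proj₂ (dualSpo π)))
theorem5p4 m n q _ _ _ π h =
    Tableau⇒SpoTableau tableau₁ bounded
  , sameShape
  , transpose-semistandard tableau₂
  , trans (shape-transpose (proj₁ (proj₂ (run ([] , [] , []) π)))) (cong conj sameShape)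
  , All.map (All.map proj₁) entries
  , record
      { range   = All.map proj₁ columns′
      ; ordered = AllPairs⇒SortedBy (reorder-sorted topSorted)
      ; lower   = All.map (proj₁ ∘ proj₂) columns′
      }
  where
  open Invariant (proj₂ (run-AStar π h))
  columns′ = reorder-All columns
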